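{- Let $n\ge 2$, $a,b\in\mathbb{N}$, $\mathbf{y}=(b,a,a,\dots,a)\in\mathbb{N}^n$ (one entry $b$ followed by $n-1$ entries $a$), and $m=b+(n-1)a$. For $\mathbf{x}=(x_1,\dots,x_n)\in[m]^n$ let $x_{(1)}\le x_{(2)}\le\cdots\le x_{(n)}$ denote the nondecreasing rearrangement of its entries. (a) If $a\mid b$ or $b>(n-1)a$, then for every $\mathbf{x}\in[m]^n$ we have $\mathbf{x}\in\mathsf{PA}^{\mathrm{inv}}_n(\mathbf{y})$ if and only if $$x_{(i)}\in\{1+(k-1)a:k\in[i]\}\quad\text{for all }i\in[n].$$ Moreover, $$|\mathsf{PA}^{\mathrm{inv}}_n(\mathbf{y})|=(n+1)^{n-1}\quad\text{and}\quad|\mathsf{PA}^{\mathrm{inv},\uparrow}_n(\mathbf{y})|=\frac{1}{n+1}\binom{2n}{n}.$$ (b) Otherwise, if $a\nmid b$ and $b<(n-1)a$, then for every $\mathbf{x}\in[m]^n$ we have $\mathbf{x}\in\mathsf{PA}^{\mathrm{inv}}_n(\mathbf{y})$ if and only if $$x_{(i)}\in\begin{cases}\{1+(k-1)a:k\in[i]\}&\text{for all }i\in\left[\lfloor b/a\rfloor+1\right],\\ \left\{1+(k-1)a:k\in\left[\lfloor b/a\rfloor+1\right]\right\}&\text{for all other }i\in[n].\end{cases}$$ Moreover, $$|\mathsf{PA}^{\mathrm{inv}}_n(\mathbf{y})|=\sum_{j=0}^{n-\lfloor b/a\rfloor-1}(-1)^j\binom{n}{j}\left(n-\left\lfloor\frac{b}{a}\right\rfloor-j\right)^j(n-j+1)^{n-j-1}$$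 and $$|\mathsf{PA}^{\mathrm{inv},\uparrow}_n(\mathbf{y})|=\frac{n-\lfloor b/a\rfloor+1}{n+1}\binom{n+\lfloor b/a\rfloor}{\lfloor b/a\rfloor}.$$
   Context: $\mathbb{N}=\{1,2,3,\dots\}$ and $[n]=\{1,\dots,n\}$. Let $\mathbf{y}=(y_1,\dots,y_n)\in\mathbb{N}^n$ and $m=\sum_{i=1}^n y_i$. Consider a one-way street with $m$ parking spots numbered $1,\dots,m$ and $n$ cars entering in order $1,2,\dots,n$, where car $i$ has length $y_i$ and prefers spot $x_i\in[m]$. Car $i$ drives to spot $x_i$ and parks in $x_i,x_i+1,\dots,x_i+y_i-1$ if these spots exist and are all unoccupied; otherwise it parks in the next $y_i$ contiguous available spots, i.e. it occupies $s,s+1,\dots,s+y_i-1$ for the smallest $s\ge x_i$ such that $s+y_i-1\le m$ and all these spots are unoccupied; if no such $s$ exists, parking fails. The vector $\mathbf{x}=(x_1,\dots,x_n)\in[m]^n$ is a parking assortment for $\mathbf{y}$ if all cars can park; the set of these is $\mathsf{PA}_n(\mathbf{y})$. A parking assortment $\mathbf{x}$ is (permutation) invariant if every permutation of its entries is also in $\mathsf{PA}_n(\mathbf{y})$; $\mathsf{PA}^{\mathrm{inv}}_n(\mathbf{y})$ is the set of invariant parking assortments for $\mathbf{y}$, and $\mathsf{PA}^{\mathrm{inv},\uparrow}_n(\mathbf{y})\subseteq\mathsf{PA}^{\mathrm{inv}}_n(\mathbf{y})$ is its subset of nondecreasing elements. -}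

module Defs where

open import Data.Fin.Base as Fin using (Fin; toℕ)
import Data.Fin.Properties as Fin
open import Data.Integer.Properties using (+-0-monoid)
open import Data.List.Base as List using (List)
open import Data.List.Membership.Propositional using () renaming (_∈_ to _∈ˡ_)
open import Data.List.Relation.Binary.Permutation.Propositional using (_↭_)
open import Data.List.Relation.Binary.Permutation.Propositional.Properties using (↭-length)
open import Data.List.Relation.Unary.Unique.Propositional using (Unique)
import Data.List.Sort as Sort
open import Data.Nat.Base using (ℕ; zero; suc; _+_; _*_; _∸_; _≤_; _<_)
open import Data.Product.Base using (∃-syntax; _×_)
open import Data.Unit.Base using (⊤)
open import Data.Vec.Base using (Vec; []; _∷_; cast; fromList; lookup; replicate; sum; toList)
open import Data.Vec.Properties using (length-toList)
open import Data.Vec.Relation.Unary.Linked using (Linked)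
open import Function.Bundles using (_⇔_)
open import Level using (0ℓ)
open import Relation.Binary.PropositionalEquality using (_≡_; trans)
open import Relation.Unary using (Pred; ∅; _∪_; _∩_; _∈_; _∉_)

open import Algebra.Properties.Monoid.Sum +-0-monoid public using (sum⁺-syntax)

private variable
  m n : ℕ
  A   : Set

-- The street 1, …, m is Fin m; the element p stands for the spot numbered
-- suc (toℕ p).
spot : Fin m → ℕ
spot p = suc (toℕ p)

Block : Fin m → ℕ → Pred (Fin m) 0ℓ
Block s ℓ p = spot s ≤ spot p × spot p < spot s + ℓ

Fits : Pred (Fin m) 0ℓ → ℕ → Pred (Fin m) 0ℓ
Fits {m} occupied ℓ s = spot s + ℓ ∸ 1 ≤ m × (∀ p → p ∈ Block s ℓ → p ∉ occupied)

-- If the preferred spot x itself fits, it is the least s ≥ x that fits, so the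
-- rule "park at x if possible, otherwise at the next place" is this one clause.
ParksAt : Pred (Fin m) 0ℓ → ℕ → Fin m → Pred (Fin m) 0ℓ
ParksAt occupied ℓ x s =
  x Fin.≤ s × s ∈ Fits occupied ℓ × (∀ t → x Fin.≤ t → t ∈ Fits occupied ℓ → s Fin.≤ t)

AllPark : Pred (Fin m) 0ℓ → Vec ℕ n → Pred (Vec (Fin m) n) 0ℓ
AllPark occupied []       []       = ⊤
AllPark occupied (ℓ ∷ ℓs) (x ∷ xs) =
  ∃[ s ] ParksAt occupied ℓ x s × AllPark (occupied ∪ Block s ℓ) ℓs xs

PA : (y : Vec ℕ n) → Pred (Vec (Fin (sum y)) n) 0ℓ
PA y = AllPark ∅ y

PAinv : (y : Vec ℕ n) → Pred (Vec (Fin (sum y)) n) 0ℓ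
PAinv y x = ∀ x′ → toList x′ ↭ toList x → x′ ∈ PA y

PAinv↑ : (y : Vec ℕ n) → Pred (Vec (Fin (sum y)) n) 0ℓ
PAinv↑ y = PAinv y ∩ Linked Fin._≤_

-- Finite cardinality: a duplicate-free list of exactly the elements of P.
HasCardinality : Pred A 0ℓ → ℕ → Set
HasCardinality {A} P k =
  ∃[ xs ] Unique {A = A} xs × (∀ x → x ∈ˡ xs ⇔ x ∈ P) × List.length xs ≡ k

rearrange↑ : Vec (Fin m) n → Vec (Fin m) n
rearrange↑ {m} x = cast (trans (↭-length (sort-↭ (toList x))) (length-toList x)) (fromList (sort (toList x)))
  where open Sort (Fin.≤-decTotalOrder m) using (sort; sort-↭)

-- The entry x₍ᵢ₎, with i read as the index spot i ∈ [n].
orderStatistic : Vec (Fin m) n → Fin n → ℕ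
orderStatistic x i = spot (lookup (rearrange↑ x) i)

-- { 1 + (k - 1) a : k ∈ [j] }
Progression : ℕ → ℕ → Pred ℕ 0ℓ
Progression a j v = ∃[ k ] 1 ≤ k × k ≤ j × v ≡ 1 + (k ∸ 1) * a

-- (b, a, …, a)
lengths : (n a b : ℕ) → Vec ℕ n
lengths zero    a b = []
lengths (suc n) a b = b ∷ replicate n a

{-# OPTIONS --safe #-}
module Submission where

-- Write m = b + (n - 1) a and count spots from 0.  The first car parks exactly
-- at its preference, and all spots are eventually taken, so the gap in front of
-- it is tiled by cars of length a: every entry of an invariant assortment is a
-- multiple of a.  Placing an entry ≥ ua first and measuring the street behind
-- ua shows that at most n - u entries are ≥ ua.  If a ∤ b, an entry ≥ b placed
-- second, after an entry 0, would leave a gap behind the first car that is not a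
-- multiple of a.  Conversely these conditions put every car into one of the n - 1
-- slots of length a left by the first car, by a Hall type invariant.
--
-- In units of a the assortments are the parking functions of length n with
-- entries at most r.  Splitting off the largest value turns their number into
-- a truncated binomial transform, solved in closed form by sequences
-- C(k,i) c^(k-i); the weakly increasing ones are counted by ballot numbers.

open import Data.Bool.Base using (Bool; false; not; true)
open import Data.Fin.Base as Fin using (Fin; fromℕ<; suc; toℕ; zero)
import Data.Fin.Properties as Fin
open import Data.Integer.Base as ℤ using (+_; -1ℤ; -[1+_]; 0ℤ; 1ℤ; ℤ)
import Data.Integer.Properties as ℤ
open import Algebra.Properties.Monoid.Sum ℤ.+-0-monoid using (sum-cong-≗)
import Data.Integer.Tactic.RingSolver as ℤ-Solver
open import Data.List.Base as List using (List; []; _++_; _∷_; applyUpTo; filter; length; map; reverse; tabulate)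
open import Data.List.Membership.Propositional using () renaming (_∈_ to _∈ˡ_)
open import Data.List.Membership.Propositional.Properties using (∈-++⁺ʳ; ∈-++⁺ˡ; ∈-++⁻; ∈-applyUpTo⁺; ∈-applyUpTo⁻; ∈-lookup; ∈-map⁺; ∈-map⁻)
open import Data.List.Properties using (++-identityʳ; filter-++; filter-accept; filter-all; filter-none; filter-reject; length-++; length-applyUpTo; length-filter; length-map; length-reverse; length-tabulate; map-id-local; map-∘; reverse-involutive; unfold-reverse; ∷-injective)
open import Data.List.Relation.Binary.Permutation.Propositional using (_↭_; prep; swap; ↭-refl; ↭-sym; ↭-trans)
import Data.List.Relation.Binary.Permutation.Propositional.Properties as Perm
open import Data.List.Relation.Unary.All as All using (All; []; _∷_)
import Data.List.Relation.Unary.All.Properties as All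
open import Data.List.Relation.Unary.AllPairs as AllPairs using (AllPairs; []; _∷_)
import Data.List.Relation.Unary.AllPairs.Properties as AllPairs
open import Data.List.Relation.Unary.Any using (here; there)
open import Data.List.Relation.Unary.Linked.Properties using (Linked⇒AllPairs)
open import Data.List.Relation.Unary.Unique.Propositional using (Unique)
import Data.List.Relation.Unary.Unique.Propositional.Properties as Unique
import Data.List.Sort as Sort
open import Data.Nat.Base
open import Data.Nat.Combinatorics using (_C_; k>n⇒nCk≡0; nCk+nC[k+1]≡[n+1]C[k+1]; nCk≡nC[n∸k]; nCn≡1)
open import Data.Nat.DivMod using (/-monoˡ-≤; _/_; _mod_; m%n<n; m*n/n≡m; m/n*n≡m; m/n*n≤m; m<n*o⇒m/o<n; m<n⇒m%n≡m; m≡m%n+[m/n]*n)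
open import Data.Nat.Divisibility
open import Data.Nat.Properties
import Data.Nat.Tactic.RingSolver as ℕ-Solver
open import Data.Product.Base using (_,_; _×_; map₁; proj₁; proj₂; uncurry; ∃-syntax)
open import Data.Rational.Base as ℚ using (ℚ)
import Data.Rational.Properties as ℚ
open import Data.Rational.Unnormalised.Base as ℚᵘ using (*≡*; mkℚᵘ)
import Data.Rational.Unnormalised.Properties as ℚᵘ
open import Data.Sum.Base using (_⊎_; inj₁; inj₂)
open import Data.Unit.Base using (tt; ⊤)
open import Data.Vec.Base as Vec using (Vec; []; _∷_; fromList; lookup; replicate; sum; toList)
import Data.Vec.Properties as Vec
open import Data.Vec.Relation.Unary.Linked using (Linked; [-]; []; _∷_)
open import Defs
open import Function.Base using (_∘_; flip)
open import Function.Bundles using (Equivalence; _⇔_; mk⇔)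
open import Level using (0ℓ)
open import Relation.Binary.PropositionalEquality
open import Relation.Nullary
open import Relation.Nullary.Decidable using (dec-false; dec-true)
open import Relation.Unary using (Pred; _∈_; _∉_; _∩_; _∪_; _⊆_; ∅)

-- Both cases of the theorem become one statement with a parameter r: entries are multiples of a, at
-- most r a, with at most n - u of them from u a on; r is n - 1 in (a) and the quotient of b by a in
-- (b). If a does not divide b but b > (n - 1) a, the counts alone keep all entries at most (n - 1)
-- a < b, so no car prefers a spot behind the first b ones and the obstruction of (b) cannot arise.
-- The closed form comes from generating functions. Let L_u belong to parking functions with entries
-- below u. Admitting the value u multiplies L_u by e^x and deletes the coefficient of x^u. Sums
-- over d of c_(u+d) e^(-(d+1)x) x^(u+d) / (u+d)! are stable under this: every exponential gains a
-- factor e^x, and the term d = 0 turns into a multiple of the bare monomial x^u, exactly what is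
-- deleted. The start L_0 = 1 then requires the sum of c_d (x e^(-x))^d / d! to be e^x, and the tree
-- function gives c_d = (d+1)^(d-1).

private variable
  A B : Set
  m n N k ℓ lo hi t : ℕ
  occ occ′ : Pred (Fin m) 0ℓ

-- Integer sums and the binomial transform

∑< : ℕ → (ℕ → ℤ) → ℤ
∑< zero    f = 0ℤ
∑< (suc D) f = f D ℤ.+ ∑< D f

∑<-cong : ∀ D {f g : ℕ → ℤ} → (∀ d → f d ≡ g d) → ∑< D f ≡ ∑< D g
∑<-cong zero    eq = refl
∑<-cong (suc D) eq = cong₂ ℤ._+_ (eq D) (∑<-cong D eq)

∑<-zero : ∀ D {f : ℕ → ℤ} → (∀ d → f d ≡ 0ℤ) → ∑< D f ≡ 0ℤ
∑<-zero zero    eq = refl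
∑<-zero (suc D) eq = cong₂ ℤ._+_ (eq D) (∑<-zero D eq)

∑<-+ : ∀ D (f g : ℕ → ℤ) → ∑< D (λ d → f d ℤ.+ g d) ≡ ∑< D f ℤ.+ ∑< D g
∑<-+ zero    f g = refl
∑<-+ (suc D) f g = trans (cong (λ z → f D ℤ.+ g D ℤ.+ z) (∑<-+ D f g)) (interchange (f D) (g D) (∑< D f) (∑< D g))
  where
  interchange : ∀ w x y z → w ℤ.+ x ℤ.+ (y ℤ.+ z) ≡ w ℤ.+ y ℤ.+ (x ℤ.+ z)
  interchange = ℤ-Solver.solve-∀

∑<-* : ∀ D c (f : ℕ → ℤ) → ∑< D (λ d → c ℤ.* f d) ≡ c ℤ.* ∑< D f
∑<-* zero    c f = sym (ℤ.*-zeroʳ c)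
∑<-* (suc D) c f = trans (cong (λ z → c ℤ.* f D ℤ.+ z) (∑<-* D c f)) (sym (ℤ.*-distribˡ-+ c (f D) (∑< D f)))

∑<-front : ∀ D (f : ℕ → ℤ) → ∑< (suc D) f ≡ f 0 ℤ.+ ∑< D (λ d → f (suc d))
∑<-front zero    f = refl
∑<-front (suc D) f = trans (cong (ℤ._+_ (f (suc D))) (∑<-front D f)) (exchange (f (suc D)) (f 0) _)
  where
  exchange : ∀ x y z → x ℤ.+ (y ℤ.+ z) ≡ y ℤ.+ (x ℤ.+ z)
  exchange = ℤ-Solver.solve-∀

∑≤-reverse : ∀ D (f : ℕ → ℤ) → ∑[ j ≤ D ] f (D ∸ toℕ j) ≡ ∑< (suc D) f
∑≤-reverse zero    f = refl
∑≤-reverse (suc D) f = cong (ℤ._+_ (f (suc D))) (∑≤-reverse D f)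

-- If F is the exponential generating function of f, then binomialTransform f
-- has the generating function e^x F, and shifting a sequence is differentiation;
-- the recursion is the product rule.
binomialTransform : (ℕ → ℤ) → ℕ → ℤ
binomialTransform f zero    = f zero
binomialTransform f (suc k) = binomialTransform f k ℤ.+ binomialTransform (λ l → f (suc l)) k

binomialTransform-cong : ∀ k {f g : ℕ → ℤ} → (∀ {l} → l ≤ k → f l ≡ g l) →
                         binomialTransform f k ≡ binomialTransform g k
binomialTransform-cong zero    eq = eq z≤n
binomialTransform-cong (suc k) eq = cong₂ ℤ._+_ (binomialTransform-cong k λ l≤k → eq (m≤n⇒m≤1+n l≤k))
                                                (binomialTransform-cong k λ l≤k → eq (s≤s l≤k))

binomialTransform-+ : ∀ k (f g : ℕ → ℤ) → binomialTransform (λ l → f l ℤ.+ g l) k ≡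
                                          binomialTransform f k ℤ.+ binomialTransform g k
binomialTransform-+ zero    f g = refl
binomialTransform-+ (suc k) f g =
  trans (cong₂ ℤ._+_ (binomialTransform-+ k f g) (binomialTransform-+ k _ _))
        (interchange (binomialTransform f k) (binomialTransform g k) _ _)
  where
  interchange : ∀ w x y z → w ℤ.+ x ℤ.+ (y ℤ.+ z) ≡ w ℤ.+ y ℤ.+ (x ℤ.+ z)
  interchange = ℤ-Solver.solve-∀

binomialTransform-* : ∀ k c (f : ℕ → ℤ) → binomialTransform (λ l → c ℤ.* f l) k ≡ c ℤ.* binomialTransform f k
binomialTransform-* zero    c f = refl
binomialTransform-* (suc k) c f =
  trans (cong₂ ℤ._+_ (binomialTransform-* k c f) (binomialTransform-* k c _))
        (sym (ℤ.*-distribˡ-+ c (binomialTransform f k) _))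

binomialTransform-∑< : ∀ D k (w : ℕ → ℤ) (f : ℕ → ℕ → ℤ) →
  binomialTransform (λ l → ∑< D (λ d → w d ℤ.* f d l)) k ≡ ∑< D (λ d → w d ℤ.* binomialTransform (f d) k)
binomialTransform-∑< zero k w f = 0-transform k
  where
  0-transform : ∀ k → binomialTransform (λ _ → 0ℤ) k ≡ 0ℤ
  0-transform zero    = refl
  0-transform (suc k) = cong₂ ℤ._+_ (0-transform k) (0-transform k)
binomialTransform-∑< (suc D) k w f =
  trans (binomialTransform-+ k (λ l → w D ℤ.* f D l) _)
        (cong₂ ℤ._+_ (binomialTransform-* k (w D) (f D)) (binomialTransform-∑< D k w f))

-- E i c k = C(k,i) c^(k-i), the sequence of e^(cx) x^i / i!.
E : ℕ → ℤ → ℕ → ℤ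
E zero    c zero    = 1ℤ
E (suc i) c zero    = 0ℤ
E zero    c (suc k) = c ℤ.* E zero c k
E (suc i) c (suc k) = c ℤ.* E (suc i) c k ℤ.+ E i c k

-- Multiplying e^(cx) x^i / i! by e^x raises c by one, so iterating the transform never leaves this
-- family.
E-transform : ∀ i c k → binomialTransform (E i c) k ≡ E i (1ℤ ℤ.+ c) k
E-transform zero    c zero    = refl
E-transform (suc i) c zero    = refl
E-transform zero    c (suc k) =
  trans (cong₂ ℤ._+_ (E-transform zero c k)
                     (trans (binomialTransform-* k c (E zero c)) (cong (c ℤ.*_) (E-transform zero c k))))
        (expand c (E zero (1ℤ ℤ.+ c) k))
  where
  expand : ∀ c x → x ℤ.+ c ℤ.* x ≡ (1ℤ ℤ.+ c) ℤ.* x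
  expand = ℤ-Solver.solve-∀
E-transform (suc i) c (suc k) =
  trans (cong₂ ℤ._+_ (E-transform (suc i) c k)
          (trans (binomialTransform-+ k (λ l → c ℤ.* E (suc i) c l) (E i c))
            (cong₂ ℤ._+_ (trans (binomialTransform-* k c (E (suc i) c)) (cong (c ℤ.*_) (E-transform (suc i) c k)))
                         (E-transform i c k))))
        (expand c (E (suc i) (1ℤ ℤ.+ c) k) (E i (1ℤ ℤ.+ c) k))
  where
  expand : ∀ c x y → x ℤ.+ (c ℤ.* x ℤ.+ y) ≡ (1ℤ ℤ.+ c) ℤ.* x ℤ.+ y
  expand = ℤ-Solver.solve-∀

E-zero : ∀ {i k} c → k < i → E i c k ≡ 0ℤ
E-zero {suc i} {zero}  c _           = refl
E-zero {suc i} {suc k} c (s≤s k<i) =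
  cong₂ ℤ._+_ (trans (cong (c ℤ.*_) (E-zero c (m≤n⇒m≤1+n k<i))) (ℤ.*-zeroʳ c)) (E-zero c k<i)

E₀-zero : ∀ {i k} → i < k → E i 0ℤ k ≡ 0ℤ
E₀-zero {zero}  {suc k} _         = refl
E₀-zero {suc i} {suc k} (s≤s i<k) = cong₂ ℤ._+_ (refl {x = 0ℤ}) (E₀-zero i<k)

-- This is the substitution of e x for x. Powers of e stand on both sides so that no exponent k - i
-- appears.
E-scale : ∀ i c e k → E i (c ℤ.* e) k ℤ.* e ℤ.^ i ≡ E i c k ℤ.* e ℤ.^ k
E-scale zero    c e zero    = refl
E-scale (suc i) c e zero    = refl
E-scale zero    c e (suc k) =
  trans (reassoc c e (E zero (c ℤ.* e) k) (e ℤ.^ 0)) (trans (cong (λ z → c ℤ.* e ℤ.* z) (E-scale zero c e k))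
  (shuffle c e (E zero c k) (e ℤ.^ k)))
  where
  reassoc : ∀ c e x y → c ℤ.* e ℤ.* x ℤ.* y ≡ c ℤ.* e ℤ.* (x ℤ.* y)
  reassoc = ℤ-Solver.solve-∀
  shuffle : ∀ c e x y → c ℤ.* e ℤ.* (x ℤ.* y) ≡ c ℤ.* x ℤ.* (e ℤ.* y)
  shuffle = ℤ-Solver.solve-∀
E-scale (suc i) c e (suc k) =
  trans (distribute c e (E (suc i) (c ℤ.* e) k) (E i (c ℤ.* e) k) (e ℤ.^ i))
  (trans (cong₂ (λ x y → c ℤ.* e ℤ.* x ℤ.+ e ℤ.* y) (E-scale (suc i) c e k) (E-scale i c e k))
  (collect c e (E (suc i) c k) (E i c k) (e ℤ.^ k)))
  where
  distribute : ∀ c e x y z → (c ℤ.* e ℤ.* x ℤ.+ y) ℤ.* (e ℤ.* z) ≡ c ℤ.* e ℤ.* (x ℤ.* (e ℤ.* z)) ℤ.+ e ℤ.* (y ℤ.* z)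
  distribute = ℤ-Solver.solve-∀
  collect : ∀ c e x y z → c ℤ.* e ℤ.* (x ℤ.* z) ℤ.+ e ℤ.* (y ℤ.* z) ≡ (c ℤ.* x ℤ.+ y) ℤ.* (e ℤ.* z)
  collect = ℤ-Solver.solve-∀

-- Finite differences and the closed form of the truncated transform

Δ : ℕ → (ℕ → ℤ) → ℕ → ℤ
Δ zero    g x = g x
Δ (suc k) g x = Δ k g (suc x) ℤ.- Δ k g x

Δ-shift : ∀ k (g : ℕ → ℤ) x → Δ k (λ z → g (suc z)) x ≡ Δ k g (suc x)
Δ-shift zero    g x = refl
Δ-shift (suc k) g x = cong₂ ℤ._-_ (Δ-shift k g (suc x)) (Δ-shift k g x)

-- `E d -1ℤ k` is C(k,d) (-1)^(k-d), the coefficient of g d in the k-th difference. Its Pascal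
-- recursion splits the sum into differences at 1 and at 0; terms with d > k vanish, so any D > k
-- serves.
Δ-expansion : ∀ k D (g : ℕ → ℤ) → k < D → ∑< D (λ d → E d -1ℤ k ℤ.* g d) ≡ Δ k g 0
Δ-expansion zero (suc D) g _ =
  trans (∑<-front D (λ d → E d -1ℤ 0 ℤ.* g d))
        (trans (cong₂ ℤ._+_ (ℤ.*-identityˡ (g 0)) (∑<-zero D λ _ → refl)) (ℤ.+-identityʳ (g 0)))
Δ-expansion (suc k) (suc D) g (s≤s k<D) = begin
  ∑< (suc D) (λ d → E d -1ℤ (suc k) ℤ.* g d)
    ≡⟨ ∑<-front D (λ d → E d -1ℤ (suc k) ℤ.* g d) ⟩
  -1ℤ ℤ.* E 0 -1ℤ k ℤ.* g 0 ℤ.+ ∑< D (λ d → (-1ℤ ℤ.* E (suc d) -1ℤ k ℤ.+ E d -1ℤ k) ℤ.* g (suc d))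
    ≡⟨ cong (ℤ._+_ (-1ℤ ℤ.* E 0 -1ℤ k ℤ.* g 0)) (trans (∑<-cong D λ d → split (E (suc d) -1ℤ k) (E d -1ℤ k) (g (suc d)))
      (trans (∑<-+ D (λ d → -1ℤ ℤ.* left d) right) (cong (λ z → z ℤ.+ ∑< D right) (∑<-* D -1ℤ left)))) ⟩
  -1ℤ ℤ.* E 0 -1ℤ k ℤ.* g 0 ℤ.+ (-1ℤ ℤ.* ∑< D left ℤ.+ ∑< D right)
    ≡⟨ regroup (E 0 -1ℤ k) (g 0) (∑< D left) (∑< D right) ⟩
  ∑< D right ℤ.- (E 0 -1ℤ k ℤ.* g 0 ℤ.+ ∑< D left)
    ≡⟨ cong₂ ℤ._-_ (trans (Δ-expansion k D (λ z → g (suc z)) k<D) (Δ-shift k g 0))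
                   (trans (sym (∑<-front D (λ d → E d -1ℤ k ℤ.* g d))) (Δ-expansion k (suc D) g (m≤n⇒m≤1+n k<D))) ⟩
  Δ (suc k) g 0 ∎
  where
  open ≡-Reasoning
  left right : ℕ → ℤ
  left  d = E (suc d) -1ℤ k ℤ.* g (suc d)
  right d = E d -1ℤ k ℤ.* g (suc d)
  split : ∀ x y z → (-1ℤ ℤ.* x ℤ.+ y) ℤ.* z ≡ -1ℤ ℤ.* (x ℤ.* z) ℤ.+ y ℤ.* z
  split = ℤ-Solver.solve-∀
  regroup : ∀ x y s t → -1ℤ ℤ.* x ℤ.* y ℤ.+ (-1ℤ ℤ.* s ℤ.+ t) ≡ t ℤ.- (x ℤ.* y ℤ.+ s)
  regroup = ℤ-Solver.solve-∀

-- Leibniz rule for the factor z + 1: its first difference is 1 and the higher ones vanish, so two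
-- terms remain.
Δ-product : ∀ k (g : ℕ → ℤ) x → Δ (suc k) (λ z → + suc z ℤ.* g z) x ≡
                                + suc x ℤ.* Δ (suc k) g x ℤ.+ + suc k ℤ.* Δ k g (suc x)
Δ-product zero    g x = rule (+ suc x) (g x) (g (suc x))
  where
  rule : ∀ X u v → (1ℤ ℤ.+ X) ℤ.* v ℤ.- X ℤ.* u ≡ X ℤ.* (v ℤ.- u) ℤ.+ 1ℤ ℤ.* v
  rule = ℤ-Solver.solve-∀
Δ-product (suc k) g x =
  trans (cong₂ ℤ._-_ (Δ-product k g (suc x)) (Δ-product k g x))
        (rule (+ suc x) (+ suc k) (Δ k g (2 + x)) (Δ k g (suc x)) (Δ k g x))
  where
  rule : ∀ X K u v w →
    (1ℤ ℤ.+ X) ℤ.* (u ℤ.- v) ℤ.+ K ℤ.* u ℤ.- (X ℤ.* (v ℤ.- w) ℤ.+ K ℤ.* v) ≡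
    X ℤ.* (u ℤ.- v ℤ.- (v ℤ.- w)) ℤ.+ (1ℤ ℤ.+ K) ℤ.* (u ℤ.- v)
  rule = ℤ-Solver.solve-∀

Δ-power : ∀ d k x → d < k → Δ k (λ z → (+ suc z) ℤ.^ d) x ≡ 0ℤ
Δ-power zero (suc zero)    x _ = refl
Δ-power zero (suc (suc k)) x _ = cong₂ ℤ._-_ (Δ-power zero (suc k) (suc x) z<s) (Δ-power zero (suc k) x z<s)
Δ-power (suc d) (suc k) x (s≤s d<k) =
  trans (Δ-product k (λ z → (+ suc z) ℤ.^ d) x)
        (cong₂ ℤ._+_ (trans (cong (+ suc x ℤ.*_) (Δ-power d (suc k) x (m≤n⇒m≤1+n d<k))) (ℤ.*-zeroʳ (+ suc x)))
                     (trans (cong (+ suc k ℤ.*_) (Δ-power d k (suc x) d<k)) (ℤ.*-zeroʳ (+ suc k))))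

-- The number of labelled trees on i + 1 vertices. At i = 0 the truncated exponent makes it 1.
treeCount : ℕ → ℤ
treeCount i = (+ suc i) ℤ.^ (i ∸ 1)


-- `E-scale` with e = d + 1 pulls the varying constant out of `E` and leaves the fixed -1. What
-- remains is a difference coefficient times a polynomial of degree k in d.
treeCount-E : ∀ d k → treeCount d ℤ.* E d -[1+ d ] (suc k) ≡ E d -1ℤ (suc k) ℤ.* (+ suc d) ℤ.^ k
treeCount-E d k = ℤ.*-cancelˡ-≡ (+ suc d) _ _ (begin
  + suc d ℤ.* (treeCount d ℤ.* E d -[1+ d ] (suc k))  ≡⟨ exchange (+ suc d) (treeCount d) _ ⟩
  E d -[1+ d ] (suc k) ℤ.* (+ suc d ℤ.* treeCount d)  ≡⟨ cong₂ (λ c z → E d c (suc k) ℤ.* z) (sym (ℤ.-1*i≡-i (+ suc d))) (power d) ⟩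
  E d (-1ℤ ℤ.* + suc d) (suc k) ℤ.* (+ suc d) ℤ.^ d     ≡⟨ E-scale d -1ℤ (+ suc d) (suc k) ⟩
  E d -1ℤ (suc k) ℤ.* (+ suc d ℤ.* (+ suc d) ℤ.^ k)     ≡⟨ rotate (E d -1ℤ (suc k)) (+ suc d) ((+ suc d) ℤ.^ k) ⟩
  + suc d ℤ.* (E d -1ℤ (suc k) ℤ.* (+ suc d) ℤ.^ k)     ∎)
  where
  open ≡-Reasoning
  exchange : ∀ x y z → x ℤ.* (y ℤ.* z) ≡ z ℤ.* (x ℤ.* y)
  exchange = ℤ-Solver.solve-∀
  rotate : ∀ x y z → x ℤ.* (y ℤ.* z) ≡ y ℤ.* (x ℤ.* z)
  rotate = ℤ-Solver.solve-∀
  power : ∀ d → + suc d ℤ.* treeCount d ≡ (+ suc d) ℤ.^ d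
  power zero    = refl
  power (suc d) = refl

-- Isolates what an enumeration has to deliver: `L u k` is meant to count parking functions of
-- length k with entries below u.
record PFRecursion (L : ℕ → ℕ → ℤ) : Set where
  field
    L₀₀ : L 0 0 ≡ 1ℤ
    L₀₁ : ∀ k → L 0 (suc k) ≡ 0ℤ
    L₁  : ∀ {u k} → u < k → L (suc u) k ≡ binomialTransform (L u) k
    L₁₀ : ∀ {u k} → k ≤ u → L (suc u) k ≡ 0ℤ

  formula : ∀ u D k → k < u + D → L u k ≡ ∑< D (λ d → treeCount (u + d) ℤ.* E (u + d) -[1+ d ] k)
  formula zero (suc D) zero _ = trans L₀₀ (sym (trans (∑<-front D (λ d → treeCount d ℤ.* E d -[1+ d ] 0))
    (cong (ℤ._+_ 1ℤ) (∑<-zero D λ d → ℤ.*-zeroʳ (treeCount (suc d))))))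
  -- The sum is a difference of order k + 1 of the polynomial (z + 1)^k, hence zero.
  formula zero D (suc k) k<D = trans (L₀₁ k) (sym (trans (∑<-cong D λ d → treeCount-E d k)
    (trans (Δ-expansion (suc k) D (λ z → (+ suc z) ℤ.^ k) k<D) (Δ-power k (suc k) 0 (n<1+n k)))))
  formula (suc u) D k k<u+D with k ≤? u
  ... | yes k≤u = trans (L₁₀ k≤u) (sym (∑<-zero D λ d →
          trans (cong (treeCount (suc u + d) ℤ.*_) (E-zero -[1+ d ] (s≤s (≤-trans k≤u (m≤m+n u d)))))
                (ℤ.*-zeroʳ (treeCount (suc u + d)))))
  ... | no  k≰u = begin
    L (suc u) k
      ≡⟨ L₁ u<k ⟩
    binomialTransform (L u) k
      -- One more term is taken for `u`, because its term d = 0 is lost below.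
      ≡⟨ binomialTransform-cong k (λ {l} l≤k → formula u (suc D) l (≤-<-trans l≤k (subst (k <_) (sym (+-suc u D)) k<u+D))) ⟩
    binomialTransform (λ l → ∑< (suc D) (λ d → treeCount (u + d) ℤ.* E (u + d) -[1+ d ] l)) k
      ≡⟨ binomialTransform-∑< (suc D) k (λ d → treeCount (u + d)) (λ d l → E (u + d) -[1+ d ] l) ⟩
    ∑< (suc D) (λ d → treeCount (u + d) ℤ.* binomialTransform (E (u + d) -[1+ d ]) k)
      ≡⟨ ∑<-cong (suc D) (λ d → cong (treeCount (u + d) ℤ.*_) (E-transform (u + d) -[1+ d ] k)) ⟩
    ∑< (suc D) (λ d → treeCount (u + d) ℤ.* E (u + d) (1ℤ ℤ.+ -[1+ d ]) k)
      ≡⟨ ∑<-front D (λ d → treeCount (u + d) ℤ.* E (u + d) (1ℤ ℤ.+ -[1+ d ]) k) ⟩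
    treeCount (u + 0) ℤ.* E (u + 0) 0ℤ k ℤ.+ ∑< D (λ d → treeCount (u + suc d) ℤ.* E (u + suc d) -[1+ d ] k)
      -- The transform has turned the term d = 0 into a multiple of x^u / u!, which has no
      -- coefficient at k > u.
      ≡⟨ cong₂ ℤ._+_ (trans (cong (treeCount (u + 0) ℤ.*_) (E₀-zero (subst (_< k) (sym (+-identityʳ u)) u<k)))
                            (ℤ.*-zeroʳ (treeCount (u + 0))))
                     (∑<-cong D λ d → cong (λ i → treeCount i ℤ.* E i -[1+ d ] k) (+-suc u d)) ⟩
    0ℤ ℤ.+ ∑< D (λ d → treeCount (suc u + d) ℤ.* E (suc u + d) -[1+ d ] k)
      ≡⟨ ℤ.+-identityˡ _ ⟩
    ∑< D (λ d → treeCount (suc u + d) ℤ.* E (suc u + d) -[1+ d ] k) ∎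
    where
    open ≡-Reasoning
    u<k = ≰⇒> k≰u

nC0≡1 : ∀ n → n C 0 ≡ 1
nC0≡1 n = trans (nCk≡nC[n∸k] {0} {n} z≤n) (nCn≡1 n)

E-binomial : ∀ i c k → E i c k ≡ + (k C i) ℤ.* c ℤ.^ (k ∸ i)
E-binomial zero    c k = trans (power k) (sym (trans (cong (λ z → + z ℤ.* c ℤ.^ k) (nC0≡1 k)) (ℤ.*-identityˡ (c ℤ.^ k))))
  where
  power : ∀ k → E 0 c k ≡ c ℤ.^ k
  power zero    = refl
  power (suc k) = cong (c ℤ.*_) (power k)
E-binomial (suc i) c zero    = sym (cong (λ z → + z ℤ.* 1ℤ) (k>n⇒nCk≡0 {0} {suc i} z<s))
E-binomial (suc i) c (suc k) = begin
  c ℤ.* E (suc i) c k ℤ.+ E i c k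
    ≡⟨ cong₂ (λ x y → c ℤ.* x ℤ.+ y) (E-binomial (suc i) c k) (E-binomial i c k) ⟩
  c ℤ.* (+ (k C suc i) ℤ.* c ℤ.^ (k ∸ suc i)) ℤ.+ + (k C i) ℤ.* c ℤ.^ (k ∸ i)
    ≡⟨ cong (λ z → z ℤ.+ + (k C i) ℤ.* c ℤ.^ (k ∸ i)) absorb ⟩
  + (k C suc i) ℤ.* c ℤ.^ (k ∸ i) ℤ.+ + (k C i) ℤ.* c ℤ.^ (k ∸ i)
    ≡⟨ collect (+ (k C suc i)) (+ (k C i)) (c ℤ.^ (k ∸ i)) ⟩
  (+ (k C i) ℤ.+ + (k C suc i)) ℤ.* c ℤ.^ (k ∸ i)
    ≡⟨ cong (λ z → + z ℤ.* c ℤ.^ (k ∸ i)) (nCk+nC[k+1]≡[n+1]C[k+1] k i) ⟩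
  + (suc k C suc i) ℤ.* c ℤ.^ (k ∸ i) ∎
  where
  open ≡-Reasoning
  collect : ∀ x y z → x ℤ.* z ℤ.+ y ℤ.* z ≡ (y ℤ.+ x) ℤ.* z
  collect = ℤ-Solver.solve-∀
  rotate : ∀ x y z → x ℤ.* (y ℤ.* z) ≡ y ℤ.* (x ℤ.* z)
  rotate = ℤ-Solver.solve-∀
  absorb : c ℤ.* (+ (k C suc i) ℤ.* c ℤ.^ (k ∸ suc i)) ≡ + (k C suc i) ℤ.* c ℤ.^ (k ∸ i)
  absorb with suc i ≤? k
  ... | yes i<k = trans (rotate c (+ (k C suc i)) (c ℤ.^ (k ∸ suc i)))
                        (cong (λ z → + (k C suc i) ℤ.* c ℤ.^ z) (sym (∸-suc i<k)))
    where
    ∸-suc : ∀ {i k} → i < k → k ∸ i ≡ suc (k ∸ suc i)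
    ∸-suc {zero}  {suc k} _         = refl
    ∸-suc {suc i} {suc k} (s≤s i<k) = ∸-suc i<k
  ... | no  i≮k rewrite k>n⇒nCk≡0 (≰⇒> i≮k) = ℤ.*-zeroʳ c

pos-^ : ∀ m k → + (m ^ k) ≡ (+ m) ℤ.^ k
pos-^ m zero    = refl
pos-^ m (suc k) = trans (ℤ.pos-* m (m ^ k)) (cong (+ m ℤ.*_) (pos-^ m k))

negsuc-^ : ∀ d k → -[1+ d ] ℤ.^ k ≡ -1ℤ ℤ.^ k ℤ.* + (suc d ^ k)
negsuc-^ d zero    = refl
negsuc-^ d (suc k) = begin
  -[1+ d ] ℤ.* -[1+ d ] ℤ.^ k                             ≡⟨ cong₂ ℤ._*_ (sym (ℤ.-1*i≡-i (+ suc d))) (negsuc-^ d k) ⟩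
  -1ℤ ℤ.* + suc d ℤ.* (-1ℤ ℤ.^ k ℤ.* + (suc d ^ k))      ≡⟨ shuffle -1ℤ (+ suc d) (-1ℤ ℤ.^ k) (+ (suc d ^ k)) ⟩
  -1ℤ ℤ.* -1ℤ ℤ.^ k ℤ.* (+ suc d ℤ.* + (suc d ^ k))      ≡⟨ cong (-1ℤ ℤ.* -1ℤ ℤ.^ k ℤ.*_) (sym (ℤ.pos-* (suc d) (suc d ^ k))) ⟩
  -1ℤ ℤ.* -1ℤ ℤ.^ k ℤ.* + (suc d * suc d ^ k)             ∎
  where
  open ≡-Reasoning
  shuffle : ∀ w x y z → w ℤ.* x ℤ.* (y ℤ.* z) ≡ w ℤ.* y ℤ.* (x ℤ.* z)
  shuffle = ℤ-Solver.solve-∀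

module _ {L : ℕ → ℕ → ℤ} (rec : PFRecursion L) where
  open PFRecursion rec

  -- The sum of `formula` read backwards: with i = q + 1 + d and j = n - i, the exponent n - i
  -- becomes j, C(n,i) becomes C(n,j), and d + 1 becomes n - q - j.
  boundedCount : ∀ {q n} → q < n →
    L (suc q) n ≡ ∑[ j ≤ n ∸ q ∸ 1 ]
                    ((-1ℤ ℤ.^ toℕ j) ℤ.* (+ (n C toℕ j))
                      ℤ.* (+ ((n ∸ q ∸ toℕ j) ^ toℕ j))
                      ℤ.* (+ ((n ∸ toℕ j + 1) ^ (n ∸ toℕ j ∸ 1))))
  boundedCount {q} {n} q<n = begin
    L (suc q) n                               ≡⟨ formula (suc q) (suc D) n (subst (n <_) (sym (+-suc (suc q) D)) (s≤s (≤-reflexive n≡))) ⟩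
    ∑< (suc D) f                              ≡⟨ sym (∑≤-reverse D f) ⟩
    ∑[ j ≤ D ] f (D ∸ toℕ j)                  ≡⟨ sum-cong-≗ {suc D} (λ j → term (toℕ j) (≤-pred (Fin.toℕ<n j))) ⟩
    ∑[ j ≤ D ] g (toℕ j)                      ∎
    where
    open ≡-Reasoning
    D = n ∸ q ∸ 1
    f g : ℕ → ℤ
    f d = treeCount (suc q + d) ℤ.* E (suc q + d) -[1+ d ] n
    g j = (-1ℤ ℤ.^ j) ℤ.* (+ (n C j)) ℤ.* (+ ((n ∸ q ∸ j) ^ j)) ℤ.* (+ ((n ∸ j + 1) ^ (n ∸ j ∸ 1)))
    n≡ : n ≡ suc q + D
    n≡ = sym (trans (cong (_+_ (suc q)) (trans (∸-+-assoc n q 1) (cong (n ∸_) (+-comm q 1)))) (m+[n∸m]≡n q<n))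
    term : ∀ j → j ≤ D → f (D ∸ j) ≡ g j
    term j j≤D = begin
      treeCount i ℤ.* E i -[1+ d ] n
        ≡⟨ cong₂ ℤ._*_ (sym (pos-^ (suc i) (i ∸ 1))) (E-binomial i -[1+ d ] n) ⟩
      + (suc i ^ (i ∸ 1)) ℤ.* (+ (n C i) ℤ.* -[1+ d ] ℤ.^ (n ∸ i))
        ≡⟨ cong (λ z → + (suc i ^ (i ∸ 1)) ℤ.* (+ (n C i) ℤ.* -[1+ d ] ℤ.^ z)) n∸i≡j ⟩
      + (suc i ^ (i ∸ 1)) ℤ.* (+ (n C i) ℤ.* -[1+ d ] ℤ.^ j)
        ≡⟨ cong₂ (λ x y → + (suc i ^ (i ∸ 1)) ℤ.* (+ x ℤ.* y))
                 (trans (nCk≡nC[n∸k] i≤n) (cong (n C_) n∸i≡j)) (negsuc-^ d j) ⟩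
      + (suc i ^ (i ∸ 1)) ℤ.* (+ (n C j) ℤ.* (-1ℤ ℤ.^ j ℤ.* + (suc d ^ j)))
        ≡⟨ reorder (+ (suc i ^ (i ∸ 1))) (+ (n C j)) (-1ℤ ℤ.^ j) (+ (suc d ^ j)) ⟩
      -1ℤ ℤ.^ j ℤ.* + (n C j) ℤ.* + (suc d ^ j) ℤ.* + (suc i ^ (i ∸ 1))
        ≡⟨ cong₂ (λ x y → -1ℤ ℤ.^ j ℤ.* + (n C j) ℤ.* + (x ^ j) ℤ.* + y) (sym n∸q∸j≡)
                 (cong₂ _^_ (trans (+-comm 1 i) (cong (_+ 1) (sym n∸j≡i))) (cong (_∸ 1) (sym n∸j≡i))) ⟩
      g j ∎
      where
      d = D ∸ j
      i = suc q + d
      n≡i+j : n ≡ i + j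
      n≡i+j = trans n≡ (trans (cong (_+_ (suc q)) (sym (m∸n+n≡m j≤D))) (sym (+-assoc (suc q) d j)))
      i≤n : i ≤ n
      i≤n = subst (i ≤_) (sym n≡i+j) (m≤m+n i j)
      n∸i≡j : n ∸ i ≡ j
      n∸i≡j = trans (cong (_∸ i) n≡i+j) (m+n∸m≡n i j)
      n∸j≡i : n ∸ j ≡ i
      n∸j≡i = trans (cong (_∸ j) n≡i+j) (m+n∸n≡m i j)
      n∸q∸j≡ : n ∸ q ∸ j ≡ suc d
      n∸q∸j≡ = trans (∸-+-assoc n q j) (trans (cong (n ∸_) (+-comm q j)) (trans (sym (∸-+-assoc n j q))
               (trans (cong (_∸ q) (trans n∸j≡i (sym (+-suc q d)))) (m+n∸m≡n q (suc d)))))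
      reorder : ∀ w x y z → w ℤ.* (x ℤ.* (y ℤ.* z)) ≡ y ℤ.* x ℤ.* z ℤ.* w
      reorder = ℤ-Solver.solve-∀

  -- When q = n - 1 only the term j = 0 of the alternating sum is left.
  fullCount : ∀ N → L (suc N) (suc N) ≡ + ((suc N + 1) ^ N)
  fullCount N = begin
    L (suc N) (suc N)  ≡⟨ boundedCount (n<1+n N) ⟩
    ∑[ j ≤ suc N ∸ N ∸ 1 ] g (toℕ j)  ≡⟨ cong (λ D → ∑[ j ≤ D ] g (toℕ j)) (cong (_∸ 1) (m+n∸n≡m 1 N)) ⟩
    1ℤ ℤ.* + (suc N C 0) ℤ.* 1ℤ ℤ.* + ((suc N + 1) ^ N) ℤ.+ 0ℤ
      ≡⟨ cong (λ z → 1ℤ ℤ.* + z ℤ.* 1ℤ ℤ.* + ((suc N + 1) ^ N) ℤ.+ 0ℤ) (nC0≡1 (suc N)) ⟩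
    1ℤ ℤ.* + ((suc N + 1) ^ N) ℤ.+ 0ℤ
      ≡⟨ trans (ℤ.+-identityʳ _) (ℤ.*-identityˡ _) ⟩
    + ((suc N + 1) ^ N) ∎
    where
    open ≡-Reasoning
    g : ℕ → ℤ
    g j = (-1ℤ ℤ.^ j) ℤ.* (+ (suc N C j)) ℤ.* (+ ((suc N ∸ N ∸ j) ^ j)) ℤ.* (+ ((suc N ∸ j + 1) ^ (suc N ∸ j ∸ 1)))

-- Binomial coefficients as lattice path counts

binom : ℕ → ℕ → ℕ
binom k u = (k + u) C u

binom-0 : ∀ k → binom k 0 ≡ 1
binom-0 k = nC0≡1 (k + 0)

binom-pascal : ∀ k u → binom (suc k) (suc u) ≡ binom (suc k) u + binom k (suc u)
binom-pascal k u = sym (trans (cong (λ z → z C u + (k + suc u) C suc u) (sym (+-suc k u)))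
                              (nCk+nC[k+1]≡[n+1]C[k+1] (k + suc u) u))

-- Both sides are (k + u + 1)! / (k! u!).
binom-absorb : ∀ k u → suc k * binom (suc k) u ≡ suc u * binom k (suc u)
binom-absorb zero u = trans (*-identityˡ _) (trans (base u) (sym (trans (cong (suc u *_) (nCn≡1 (suc u))) (*-identityʳ (suc u)))))
  where
  base : ∀ u → binom 1 u ≡ suc u
  base zero    = refl
  base (suc u) = trans (binom-pascal 0 u) (trans (cong₂ _+_ (base u) (nCn≡1 (suc u))) (+-comm (suc u) 1))
binom-absorb (suc k) zero = begin
  suc (suc k) * binom (suc (suc k)) 0               ≡⟨ cong (suc (suc k) *_) (trans (binom-0 (2 + k)) (sym (binom-0 (suc k)))) ⟩
  binom (suc k) 0 + suc k * binom (suc k) 0         ≡⟨ cong (_+_ (binom (suc k) 0)) (binom-absorb k 0) ⟩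
  binom (suc k) 0 + 1 * binom k 1                   ≡⟨ cong (_+_ (binom (suc k) 0)) (*-identityˡ (binom k 1)) ⟩
  binom (suc k) 0 + binom k 1                       ≡⟨ sym (binom-pascal k 0) ⟩
  binom (suc k) 1                                   ≡⟨ sym (*-identityˡ (binom (suc k) 1)) ⟩
  1 * binom (suc k) 1                               ∎
  where open ≡-Reasoning
binom-absorb (suc k) (suc u) = begin
  suc (suc k) * binom (2 + k) (suc u)
    ≡⟨ cong (suc (suc k) *_) (binom-pascal (suc k) u) ⟩
  suc (suc k) * (binom (2 + k) u + x)
    ≡⟨ trans (*-distribˡ-+ (2 + k) (binom (2 + k) u) x) (cong (_+ (2 + k) * x) (binom-absorb (suc k) u)) ⟩
  suc u * x + suc (suc k) * x
    ≡⟨ regroup k u x ⟩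
  suc (suc u) * x + suc k * x
    ≡⟨ trans (cong (_+_ (suc (suc u) * x)) (binom-absorb k (suc u))) (sym (*-distribˡ-+ (2 + u) x (binom k (2 + u)))) ⟩
  suc (suc u) * (x + binom k (2 + u))
    ≡⟨ cong (suc (suc u) *_) (sym (binom-pascal k (suc u))) ⟩
  suc (suc u) * binom (suc k) (2 + u) ∎
  where
  open ≡-Reasoning
  x = binom (suc k) (suc u)
  regroup : ∀ k u x → suc u * x + suc (suc k) * x ≡ suc (suc u) * x + suc k * x
  regroup = ℕ-Solver.solve-∀

-- Counting entries above a threshold

atLeast : ℕ → List ℕ → ℕ
atLeast t xs = length (filter (t ≤?_) xs)

atLeast-accept : ∀ {t x} xs → t ≤ x → atLeast t (x ∷ xs) ≡ suc (atLeast t xs)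
atLeast-accept {t} xs t≤x = cong length (filter-accept (t ≤?_) {xs = xs} t≤x)

atLeast-reject : ∀ {t x} xs → x < t → atLeast t (x ∷ xs) ≡ atLeast t xs
atLeast-reject {t} xs x<t = cong length (filter-reject (t ≤?_) {xs = xs} (<⇒≱ x<t))

atLeast-all : ∀ {t xs} → All (t ≤_) xs → atLeast t xs ≡ length xs
atLeast-all {t} t≤xs = cong length (filter-all (t ≤?_) t≤xs)

atLeast-none : ∀ {t xs} → All (_< t) xs → atLeast t xs ≡ 0
atLeast-none {t} xs<t = cong length (filter-none (t ≤?_) (All.map <⇒≱ xs<t))

-- Injectivity on the members of `xs` is enough: a repetition in `map f xs` would survive `map g`,
-- which gives back `xs`.
map-unique : {f : A → B} {g : B → A} {xs : List A} → (∀ {x} → x ∈ˡ xs → g (f x) ≡ x) →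
             Unique xs → Unique (map f xs)
map-unique {f = f} {g} {xs} inverse xs! =
  Unique.map⁻ {f = g} (subst Unique (sym (trans (sym (map-∘ xs)) (map-id-local (All.tabulate inverse)))) xs!)

when : {P : Set} → Dec P → List A → List A
when (yes _) xs = xs
when (no _)  xs = []

-- Parking functions with bounded entries

masks : (ℕ → List A) → ℕ → List (List Bool × A)
masks f zero    = map ([] ,_) (f 0)
masks f (suc k) = map (map₁ (true ∷_)) (masks f k) ++ map (map₁ (false ∷_)) (masks (f ∘ suc) k)

falses : List Bool → ℕ
falses []           = 0
falses (true  ∷ bs) = falses bs
falses (false ∷ bs) = suc (falses bs)

∈-masks⁺ : ∀ (f : ℕ → List A) bs {w} → w ∈ˡ f (falses bs) → (bs , w) ∈ˡ masks f (length bs)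
∈-masks⁺ f []           w∈ = ∈-map⁺ ([] ,_) w∈
∈-masks⁺ f (true  ∷ bs) w∈ = ∈-++⁺ˡ (∈-map⁺ (map₁ (true ∷_)) (∈-masks⁺ f bs w∈))
∈-masks⁺ f (false ∷ bs) w∈ = ∈-++⁺ʳ (map (map₁ (true ∷_)) (masks f (length bs)))
                                     (∈-map⁺ (map₁ (false ∷_)) (∈-masks⁺ (f ∘ suc) bs w∈))

∈-masks⁻ : ∀ (f : ℕ → List A) k {bs w} → (bs , w) ∈ˡ masks f k → length bs ≡ k × w ∈ˡ f (falses bs)
∈-masks⁻ f zero    p with _ , w∈ , refl ← ∈-map⁻ ([] ,_) p = refl , w∈
∈-masks⁻ f (suc k) p with ∈-++⁻ (map (map₁ (true ∷_)) (masks f k)) p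
... | inj₁ q with _ , r , refl ← ∈-map⁻ (map₁ (true ∷_)) q =
  let len , w∈ = ∈-masks⁻ f k r in cong suc len , w∈
... | inj₂ q with _ , r , refl ← ∈-map⁻ (map₁ (false ∷_)) q =
  let len , w∈ = ∈-masks⁻ (f ∘ suc) k r in cong suc len , w∈

masks-unique : ∀ (f : ℕ → List A) k → (∀ l → Unique (f l)) → Unique (masks f k)
masks-unique f zero    f! = Unique.map⁺ (λ { refl → refl }) (f! 0)
masks-unique f (suc k) f! =
  Unique.++⁺ (Unique.map⁺ (λ { refl → refl }) (masks-unique f k f!))
             (Unique.map⁺ (λ { refl → refl }) (masks-unique (f ∘ suc) k (f! ∘ suc)))
             disjoint
  where
  disjoint : ∀ {z} → ¬ (z ∈ˡ map (map₁ (true ∷_)) (masks f k) × z ∈ˡ map (map₁ (false ∷_)) (masks (f ∘ suc) k))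
  disjoint (p , q) with ∈-map⁻ _ p | ∈-map⁻ _ q
  ... | _ , _ , refl | _ , _ , ()

-- `masks` follows the recursion of `binomialTransform`: a `true` keeps f, a `false` shifts it.
length-masks : ∀ (f : ℕ → List A) k → + length (masks f k) ≡ binomialTransform (λ l → + length (f l)) k
length-masks f zero    = cong +_ (length-map _ (f 0))
length-masks f (suc k) =
  trans (cong +_ (trans (length-++ (map (map₁ (true ∷_)) (masks f k)))
                        (cong₂ _+_ (length-map _ (masks f k)) (length-map _ (masks (f ∘ suc) k)))))
        (cong₂ ℤ._+_ (length-masks f k) (length-masks (f ∘ suc) k))

-- Undoes the removal of the largest value: `true` marks the places of u, and w fills the others in
-- order. A w that is too short cuts the result off, which `length w ≡ falses bs` excludes.
merge : ℕ → List Bool → List ℕ → List ℕ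
merge u []           w       = []
merge u (true  ∷ bs) w       = u ∷ merge u bs w
merge u (false ∷ bs) []      = []
merge u (false ∷ bs) (x ∷ w) = x ∷ merge u bs w

mask : ℕ → List ℕ → List Bool
mask u = map (λ x → not (does (x <? u)))

below : ℕ → List ℕ → List ℕ
below u = filter (_<? u)

merge-mask : ∀ u x → All (_< suc u) x → merge u (mask u x) (below u x) ≡ x
merge-mask u []       []         = refl
merge-mask u (x ∷ xs) (x≤u ∷ xs≤u) = case (x <? u)
  where
  case : Dec (x < u) → merge u (mask u (x ∷ xs)) (below u (x ∷ xs)) ≡ x ∷ xs
  case (yes x<u) = trans (cong₂ (merge u) (cong (λ b → not b ∷ mask u xs) (dec-true (x <? u) x<u))
                                          (filter-accept (_<? u) x<u))
                         (cong (x ∷_) (merge-mask u xs xs≤u))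
  case (no  x≮u) = trans (cong₂ (merge u) (cong (λ b → not b ∷ mask u xs) (dec-false (x <? u) x≮u))
                                          (filter-reject (_<? u) x≮u))
                         (cong₂ _∷_ (≤-antisym (≮⇒≥ x≮u) (≤-pred x≤u)) (merge-mask u xs xs≤u))

falses-mask : ∀ u x → falses (mask u x) ≡ length (below u x)
falses-mask u []       = refl
falses-mask u (x ∷ xs) = case (x <? u)
  where
  case : Dec (x < u) → falses (mask u (x ∷ xs)) ≡ length (below u (x ∷ xs))
  case (yes x<u) = trans (cong (λ b → falses (not b ∷ mask u xs)) (dec-true (x <? u) x<u))
                         (trans (cong suc (falses-mask u xs)) (cong length (sym (filter-accept (_<? u) x<u))))
  case (no  x≮u) = trans (cong (λ b → falses (not b ∷ mask u xs)) (dec-false (x <? u) x≮u))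
                         (trans (falses-mask u xs) (cong length (sym (filter-reject (_<? u) x≮u))))

mask-merge : ∀ u bs w → length w ≡ falses bs → All (_< u) w → mask u (merge u bs w) ≡ bs × below u (merge u bs w) ≡ w
mask-merge u []           []      _   []          = refl , refl
mask-merge u (true  ∷ bs) w       len w<u         =
  let eq₁ , eq₂ = mask-merge u bs w len w<u in
  cong₂ (λ b → not b ∷_) (dec-false (u <? u) (n≮n u)) eq₁ , trans (filter-reject (_<? u) (n≮n u)) eq₂
mask-merge u (false ∷ bs) (x ∷ w) len (x<u ∷ w<u) =
  let eq₁ , eq₂ = mask-merge u bs w (suc-injective len) w<u in
  cong₂ (λ b → not b ∷_) (dec-true (x <? u) x<u) eq₁ , trans (filter-accept (_<? u) x<u) (cong (x ∷_) eq₂)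

merge-bounded : ∀ u bs w → All (_< u) w → All (_< suc u) (merge u bs w)
merge-bounded u []           w       _           = []
merge-bounded u (true  ∷ bs) w       w<u         = n<1+n u ∷ merge-bounded u bs w w<u
merge-bounded u (false ∷ bs) []      _           = []
merge-bounded u (false ∷ bs) (x ∷ w) (x<u ∷ w<u) = m<n⇒m<1+n x<u ∷ merge-bounded u bs w w<u

-- For v ≤ u the entries removed by `below u` are all counted at v, so count and length fall
-- equally. Hence the stair condition at v is the same for x and for `below u x`.
atLeast-below : ∀ {v u} x → v ≤ u → atLeast v x + length (below u x) ≡ atLeast v (below u x) + length x
atLeast-below {v} {u} []       v≤u = refl
atLeast-below {v} {u} (x ∷ xs) v≤u = case (x <? u) (v ≤? x)
  where
  open ≡-Reasoning
  case : Dec (x < u) → Dec (v ≤ x) → atLeast v (x ∷ xs) + length (below u (x ∷ xs)) ≡ atLeast v (below u (x ∷ xs)) + suc (length xs)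
  case (no x≮u) _ = begin
    atLeast v (x ∷ xs) + length (below u (x ∷ xs))
      ≡⟨ cong₂ _+_ (atLeast-accept xs (≤-trans v≤u (≮⇒≥ x≮u))) (cong length (filter-reject (_<? u) x≮u)) ⟩
    suc (atLeast v xs + length (below u xs))
      ≡⟨ trans (cong suc (atLeast-below xs v≤u)) (sym (+-suc _ (length xs))) ⟩
    atLeast v (below u xs) + suc (length xs)
      ≡⟨ cong (λ z → atLeast v z + suc (length xs)) (sym (filter-reject (_<? u) x≮u)) ⟩
    atLeast v (below u (x ∷ xs)) + suc (length xs) ∎
  case (yes x<u) (yes v≤x) = begin
    atLeast v (x ∷ xs) + length (below u (x ∷ xs))
      ≡⟨ cong₂ _+_ (atLeast-accept xs v≤x) (cong length (filter-accept (_<? u) x<u)) ⟩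
    suc (atLeast v xs + suc (length (below u xs)))
      ≡⟨ cong suc (trans (+-suc _ _) (trans (cong suc (atLeast-below xs v≤u)) (sym (+-suc _ (length xs))))) ⟩
    suc (atLeast v (below u xs)) + suc (length xs)
      ≡⟨ cong (_+ suc (length xs)) (sym (trans (cong (atLeast v) (filter-accept (_<? u) x<u)) (atLeast-accept (below u xs) v≤x))) ⟩
    atLeast v (below u (x ∷ xs)) + suc (length xs) ∎
  case (yes x<u) (no v≰x) = begin
    atLeast v (x ∷ xs) + length (below u (x ∷ xs))
      ≡⟨ cong₂ _+_ (atLeast-reject xs (≰⇒> v≰x)) (cong length (filter-accept (_<? u) x<u)) ⟩
    atLeast v xs + suc (length (below u xs))
      ≡⟨ trans (+-suc _ _) (trans (cong suc (atLeast-below xs v≤u)) (sym (+-suc _ (length xs)))) ⟩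
    atLeast v (below u xs) + suc (length xs)
      ≡⟨ cong (_+ suc (length xs)) (sym (trans (cong (atLeast v) (filter-accept (_<? u) x<u)) (atLeast-reject (below u xs) (≰⇒> v≰x)))) ⟩
    atLeast v (below u (x ∷ xs)) + suc (length xs) ∎

boundedPFs : ℕ → ℕ → List (List ℕ)
boundedPFs zero    zero    = [] ∷ []
boundedPFs zero    (suc k) = []
boundedPFs (suc u) k       = when (suc u ≤? k) (map (uncurry (merge u)) (masks (boundedPFs u) k))

-- `stair` at v means that at least v entries are below v. It is also demanded at v = u, where no
-- entry counts; this forces u ≤ k and is the source of the truncation in the recursion.
record Bounded (u k : ℕ) (x : List ℕ) : Set where
  constructor mk
  field
    len   : length x ≡ k
    bound : All (_< u) x
    stair : ∀ v → v ≤ u → v + atLeast v x ≤ length x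

boundedPFs⁻ : ∀ u k {x} → x ∈ˡ boundedPFs u k → Bounded u k x
boundedPFs⁻ zero    zero    (here refl) = mk refl [] λ { zero _ → z≤n }
boundedPFs⁻ (suc u) k x∈ with suc u ≤? k
... | yes u<k with (bs , w) , p , refl ← ∈-map⁻ (uncurry (merge u)) x∈ = mk len≡k bound stair
  where
  w-len = ∈-masks⁻ (boundedPFs u) k p
  wB = boundedPFs⁻ u (falses bs) (proj₂ w-len)
  x = merge u bs w
  m-m = mask-merge u bs w (Bounded.len wB) (Bounded.bound wB)
  len≡k : length x ≡ k
  len≡k = trans (sym (length-map _ x)) (trans (cong length (proj₁ m-m)) (proj₁ w-len))
  bound = merge-bounded u bs w (Bounded.bound wB)
  stair : ∀ v → v ≤ suc u → v + atLeast v x ≤ length x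
  stair v v≤1+u with v ≤? u
  ... | yes v≤u = +-cancelʳ-≤ (length w) _ _ (begin
    v + atLeast v x + length w               ≡⟨ +-assoc v (atLeast v x) (length w) ⟩
    v + (atLeast v x + length w)             ≡⟨ cong (λ z → v + (atLeast v x + length z)) (sym (proj₂ m-m)) ⟩
    v + (atLeast v x + length (below u x))   ≡⟨ cong (λ z → v + z) (atLeast-below x v≤u) ⟩
    v + (atLeast v (below u x) + length x)   ≡⟨ cong (λ z → v + (atLeast v z + length x)) (proj₂ m-m) ⟩
    v + (atLeast v w + length x)             ≡⟨ sym (+-assoc v (atLeast v w) (length x)) ⟩
    v + atLeast v w + length x               ≤⟨ +-monoˡ-≤ (length x) (Bounded.stair wB v v≤u) ⟩
    length w + length x                      ≡⟨ +-comm (length w) (length x) ⟩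
    length x + length w                      ∎)
    where open ≤-Reasoning
  -- Here v = u + 1 counts no entry, and the claim is the test u < k made by `boundedPFs`.
  ... | no v≰u rewrite ≤-antisym v≤1+u (≰⇒> v≰u) | atLeast-none bound | +-identityʳ u | len≡k = u<k

boundedPFs⁺ : ∀ u k {x} → Bounded u k x → x ∈ˡ boundedPFs u k
boundedPFs⁺ zero    zero    {[]} _ = here refl
boundedPFs⁺ zero    (suc k) {[]} (mk () _ _)
boundedPFs⁺ zero    k {x ∷ xs} (mk _ (() ∷ _) _)
boundedPFs⁺ (suc u) k {x} (mk refl bound stair) with suc u ≤? length x
... | no  u≮k = contradiction (≤-trans (m≤m+n (suc u) (atLeast (suc u) x)) (stair (suc u) ≤-refl)) u≮k
... | yes u<k = subst₂ (λ z k → z ∈ˡ map (uncurry (merge u)) (masks (boundedPFs u) k)) (merge-mask u x bound) (length-map _ x)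
  (∈-map⁺ (uncurry (merge u)) (∈-masks⁺ (boundedPFs u) (mask u x)
    (boundedPFs⁺ u (falses (mask u x)) (mk (sym (falses-mask u x)) (All.all-filter (_<? u) x) stair′))))
  where
  open ≤-Reasoning
  stair′ : ∀ v → v ≤ u → v + atLeast v (below u x) ≤ length (below u x)
  stair′ v v≤u = +-cancelʳ-≤ (length x) _ _ (begin
    v + atLeast v (below u x) + length x     ≡⟨ +-assoc v (atLeast v (below u x)) (length x) ⟩
    v + (atLeast v (below u x) + length x)   ≡⟨ cong (λ z → v + z) (sym (atLeast-below x v≤u)) ⟩
    v + (atLeast v x + length (below u x))   ≡⟨ sym (+-assoc v (atLeast v x) (length (below u x))) ⟩
    v + atLeast v x + length (below u x)     ≤⟨ +-monoˡ-≤ (length (below u x)) (stair v (m≤n⇒m≤1+n v≤u)) ⟩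
    length x + length (below u x)            ≡⟨ +-comm (length x) (length (below u x)) ⟩
    length (below u x) + length x            ∎)

boundedPFs-unique : ∀ u k → Unique (boundedPFs u k)
boundedPFs-unique zero    zero    = [] ∷ []
boundedPFs-unique zero    (suc k) = []
boundedPFs-unique (suc u) k with suc u ≤? k
... | no  _ = []
... | yes _ = map-unique {g = λ x → mask u x , below u x} inverse (masks-unique (boundedPFs u) k (boundedPFs-unique u))
  where
  inverse : ∀ {z} → z ∈ˡ masks (boundedPFs u) k → (mask u (uncurry (merge u) z) , below u (uncurry (merge u) z)) ≡ z
  inverse {bs , w} p =
    let wB = boundedPFs⁻ u (falses bs) (proj₂ (∈-masks⁻ (boundedPFs u) k p))
        eq₁ , eq₂ = mask-merge u bs w (Bounded.len wB) (Bounded.bound wB)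
    in cong₂ _,_ eq₁ eq₂

boundedPFs-recursion : PFRecursion (λ u k → + length (boundedPFs u k))
boundedPFs-recursion = record
  { L₀₀ = refl
  ; L₀₁ = λ _ → refl
  ; L₁  = L₁
  ; L₁₀ = L₁₀
  }
  where
  L₁ : ∀ {u k} → u < k → + length (boundedPFs (suc u) k) ≡ binomialTransform (λ l → + length (boundedPFs u l)) k
  L₁ {u} {k} u<k with suc u ≤? k
  ... | yes _   = trans (cong +_ (length-map _ (masks (boundedPFs u) k))) (length-masks (boundedPFs u) k)
  ... | no  u≮k = contradiction u<k u≮k
  L₁₀ : ∀ {u k} → k ≤ u → + length (boundedPFs (suc u) k) ≡ 0ℤ
  L₁₀ {u} {k} k≤u with suc u ≤? k
  ... | yes u<k = contradiction u<k (≤⇒≯ k≤u)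
  ... | no  _   = refl

-- Weakly decreasing rearrangements of parking functions

Descending : ℕ → List ℕ → Set
Descending u []       = ⊤
Descending u (c ∷ cs) = c ≤ u × c ≤ length cs × Descending c cs

descents : ℕ → ℕ → List (List ℕ)
descents zero    u       = [] ∷ []
descents (suc k) zero    = map (0 ∷_) (descents k 0)
descents (suc k) (suc u) = descents (suc k) u ++ when (suc u ≤? k) (map (suc u ∷_) (descents k (suc u)))

Descending-mono : ∀ {u v} xs → u ≤ v → Descending u xs → Descending v xs
Descending-mono []       u≤v _         = tt
Descending-mono (x ∷ xs) u≤v (x≤u , d) = ≤-trans x≤u u≤v , d

descents⁺ : ∀ k u {x} → length x ≡ k → Descending u x → x ∈ˡ descents k u
descents⁺ zero    u       {[]} refl d = here refl
descents⁺ (suc k) zero    {zero ∷ xs} len (_ , _ , d) = ∈-map⁺ (0 ∷_) (descents⁺ k 0 (suc-injective len) d)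
descents⁺ (suc k) (suc u) {x ∷ xs} len (x≤1+u , x≤k , d) with x ≤? u
... | yes x≤u = ∈-++⁺ˡ (descents⁺ (suc k) u len (x≤u , x≤k , d))
... | no  x≰u with refl ← ≤-antisym x≤1+u (≰⇒> x≰u) with suc u ≤? k
...   | yes _   = ∈-++⁺ʳ (descents (suc k) u) (∈-map⁺ (suc u ∷_) (descents⁺ k (suc u) (suc-injective len) d))
...   | no  u≮k = contradiction (subst (suc u ≤_) (suc-injective len) x≤k) u≮k

descents⁻ : ∀ k u {x} → x ∈ˡ descents k u → length x ≡ k × Descending u x
descents⁻ zero    u       (here refl) = refl , tt
descents⁻ (suc k) zero    p with _ , q , refl ← ∈-map⁻ (0 ∷_) p =
  let len , d = descents⁻ k 0 q in cong suc len , z≤n , z≤n , d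
descents⁻ (suc k) (suc u) {x} p with ∈-++⁻ (descents (suc k) u) p
... | inj₁ q = let len , d = descents⁻ (suc k) u q in len , Descending-mono x (n≤1+n u) d
... | inj₂ q with suc u ≤? k
...   | yes u<k with _ , r , refl ← ∈-map⁻ (suc u ∷_) q =
  let len , d = descents⁻ k (suc u) r in cong suc len , ≤-refl , subst (suc u ≤_) (sym len) u<k , d

descents-unique : ∀ k u → Unique (descents k u)
descents-unique zero    u    = [] ∷ []
descents-unique (suc k) zero = Unique.map⁺ (λ { refl → refl }) (descents-unique k 0)
descents-unique (suc k) (suc u) with suc u ≤? k
... | no  _ = Unique.++⁺ (descents-unique (suc k) u) [] λ { (_ , ()) }
... | yes _ = Unique.++⁺ (descents-unique (suc k) u) (Unique.map⁺ (λ { refl → refl }) (descents-unique k (suc u))) disjoint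
  where
  disjoint : ∀ {z} → ¬ (z ∈ˡ descents (suc k) u × z ∈ˡ map (suc u ∷_) (descents k (suc u)))
  disjoint (p , q) with _ , _ , refl ← ∈-map⁻ (suc u ∷_) q =
    contradiction (proj₁ (proj₂ (descents⁻ (suc k) u p))) 1+n≰n

length-descents₀ : ∀ k → length (descents k 0) ≡ 1
length-descents₀ zero    = refl
length-descents₀ (suc k) = trans (length-map _ (descents k 0)) (length-descents₀ k)

binom-sym : ∀ k u → binom k u ≡ binom u k
binom-sym k u = trans (nCk≡nC[n∸k] (m≤n+m u k)) (cong₂ _C_ (+-comm k u) (m+n∸n≡m k u))

-- The reflection principle: binom (suc k) u counts the bad lattice paths.
length-descents : ∀ k u → suc u ≤ k → length (descents k (suc u)) + binom (suc k) u ≡ binom k (suc u)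
length-descents (suc k) u (s≤s u≤k) = begin
  length (descents (suc k) u ++ last) + binom (2 + k) u
    ≡⟨ cong (_+ binom (2 + k) u) (length-++ (descents (suc k) u)) ⟩
  length (descents (suc k) u) + length last + binom (2 + k) u
    ≡⟨ combine u u≤k ⟩
  binom (suc k) u + (length last + binom (suc k) u)
    ≡⟨ cong (λ z → binom (suc k) u + z) last-length ⟩
  binom (suc k) u + binom k (suc u)
    ≡⟨ sym (binom-pascal k u) ⟩
  binom (suc k) (suc u) ∎
  where
  open ≡-Reasoning
  last = when (suc u ≤? k) (map (suc u ∷_) (descents k (suc u)))
  last-length : length last + binom (suc k) u ≡ binom k (suc u)
  last-length with suc u ≤? k
  ... | yes u<k = trans (cong (_+ binom (suc k) u) (length-map _ (descents k (suc u)))) (length-descents k u u<k)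
  -- Now u = k: no list starts with k + 1, and the symmetry of binomial coefficients remains.
  ... | no  u≮k with refl ← ≤-antisym u≤k (≮⇒≥ u≮k) = binom-sym (suc k) u
  combine : ∀ u {l} → u ≤ k → length (descents (suc k) u) + l + binom (2 + k) u ≡ binom (suc k) u + (l + binom (suc k) u)
  -- The bound 0 lies outside the reflection identity; it admits exactly one list.
  combine zero    {l} _ rewrite length-descents₀ (suc k) | binom-0 (suc k) | binom-0 (2 + k) = refl
  combine (suc u) {l} u<k = begin
    d + l + binom (2 + k) (suc u)                       ≡⟨ cong (λ z → d + l + z) (binom-pascal (suc k) u) ⟩
    d + l + (binom (2 + k) u + binom (suc k) (suc u))   ≡⟨ regroup d l (binom (2 + k) u) _ ⟩
    d + binom (2 + k) u + (l + binom (suc k) (suc u))   ≡⟨ cong (_+ (l + binom (suc k) (suc u))) (length-descents (suc k) u (m≤n⇒m≤1+n u<k)) ⟩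
    binom (suc k) (suc u) + (l + binom (suc k) (suc u)) ∎
    where
    d = length (descents (suc k) (suc u))
    regroup : ∀ d l x y → d + l + (x + y) ≡ d + x + (l + y)
    regroup = ℕ-Solver.solve-∀

-- After multiplication of the reflection identity by k + 1, absorption turns the bad paths into a
-- multiple of the same binomial coefficient as all paths, so the two can be subtracted.
ballot : ∀ {k u} → u ≤ k → suc k * length (descents k u) ≡ (k ∸ u + 1) * ((k + u) C u)
ballot {k} {zero}  _   = cong₂ _*_ (+-comm 1 k) (trans (length-descents₀ k) (sym (binom-0 k)))
ballot {k} {suc u} u<k = +-cancelʳ-≡ (suc u * binom k (suc u)) _ _ (begin
  suc k * d + suc u * binom k (suc u)
    ≡⟨ cong (λ z → suc k * d + z) (sym (binom-absorb k u)) ⟩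
  suc k * d + suc k * binom (suc k) u
    ≡⟨ trans (sym (*-distribˡ-+ (suc k) d _)) (cong (suc k *_) (length-descents k u u<k)) ⟩
  suc k * binom k (suc u)
    ≡⟨ cong (_* binom k (suc u)) (sym (trans (+-assoc (k ∸ suc u) 1 (suc u)) (trans (+-suc (k ∸ suc u) (suc u)) (cong suc (m∸n+n≡m u<k))))) ⟩
  (k ∸ suc u + 1 + suc u) * binom k (suc u)
    ≡⟨ *-distribʳ-+ (binom k (suc u)) (k ∸ suc u + 1) (suc u) ⟩
  (k ∸ suc u + 1) * binom k (suc u) + suc u * binom k (suc u) ∎)
  where
  open ≡-Reasoning
  d = length (descents k (suc u))

-- The stair condition and the sorted entries

prefs : Vec (Fin m) n → List ℕ
prefs x = map toℕ (toList x)

length-prefs : ∀ (x : Vec (Fin m) n) → length (prefs x) ≡ n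
length-prefs []      = refl
length-prefs (_ ∷ x) = cong suc (length-prefs x)

prefs-injective : ∀ {x x′ : Vec (Fin m) n} → prefs x ≡ prefs x′ → x ≡ x′
prefs-injective {x = []}    {[]}     _  = refl
prefs-injective {x = _ ∷ _} {_ ∷ _} eq =
  let eq₁ , eq₂ = ∷-injective eq in cong₂ _∷_ (Fin.toℕ-injective eq₁) (prefs-injective eq₂)

atLeast-∷ : ∀ t x xs → atLeast t xs ≤ atLeast t (x ∷ xs)
atLeast-∷ t x xs with t ≤? x
... | yes t≤x = ≤-trans (n≤1+n _) (≤-reflexive (sym (atLeast-accept xs t≤x)))
... | no  t≰x = ≤-reflexive (sym (atLeast-reject xs (≰⇒> t≰x)))

atLeast-scale : ∀ a .{{_ : NonZero a}} v c → atLeast (v * a) (map (_* a) c) ≡ atLeast v c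
atLeast-scale a v []       = refl
atLeast-scale a v (c ∷ cs) with v ≤? c
... | yes v≤c = trans (atLeast-accept _ (*-monoˡ-≤ a v≤c)) (trans (cong suc (atLeast-scale a v cs)) (sym (atLeast-accept cs v≤c)))
... | no  v≰c = trans (atLeast-reject _ (*-monoˡ-< a (≰⇒> v≰c))) (trans (atLeast-scale a v cs) (sym (atLeast-reject cs (≰⇒> v≰c))))

-- The condition on the sorted entries in a form that no permutation changes: `stairs` says that at
-- least u entries lie below u a.
record Stair (a r : ℕ) (xs : List ℕ) : Set where
  constructor mk
  field
    multiples : All (a ∣_) xs
    bounded   : All (_≤ r * a) xs
    stairs    : ∀ u → u ≤ length xs → u + atLeast (u * a) xs ≤ length xs

Stair-↭ : ∀ {a r xs ys} → xs ↭ ys → Stair a r xs → Stair a r ys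
Stair-↭ {a} {r} xs↭ys (mk mult bdd stairs) =
  mk (Perm.All-resp-↭ xs↭ys mult) (Perm.All-resp-↭ xs↭ys bdd)
     λ u u≤ → subst₂ (λ c l → u + c ≤ l) (Perm.↭-length (Perm.filter-↭ (u * a ≤?_) xs↭ys)) (Perm.↭-length xs↭ys)
                     (stairs u (subst (u ≤_) (sym (Perm.↭-length xs↭ys)) u≤))

lookup-atLeast : ∀ (s : Vec (Fin m) n) → AllPairs _≤_ (prefs s) → ∀ i {t} →
                 t ≤ toℕ (lookup s i) → n ≤ toℕ i + atLeast t (prefs s)
lookup-atLeast (x ∷ s) (x≤s ∷ _) zero    t≤x =
  ≤-reflexive (sym (trans (atLeast-all (t≤x ∷ All.map (≤-trans t≤x) x≤s)) (cong suc (length-prefs s))))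
lookup-atLeast (x ∷ s) (_ ∷ s↗)  (suc i) t≤  =
  s≤s (≤-trans (lookup-atLeast s s↗ i t≤) (+-monoʳ-≤ (toℕ i) (atLeast-∷ _ (toℕ x) (prefs s))))

atLeast-prefix : ∀ (s : Vec (Fin m) n) u {t} → u ≤ n → (∀ i → toℕ i < u → toℕ (lookup s i) < t) →
                 u + atLeast t (prefs s) ≤ n
atLeast-prefix s       zero    _         _    = subst (atLeast _ (prefs s) ≤_) (length-prefs s) (length-filter (_ ≤?_) (prefs s))
atLeast-prefix (x ∷ s) (suc u) (s≤s u≤n) s<t =
  s≤s (subst (λ c → u + c ≤ _) (sym (atLeast-reject (prefs s) (s<t zero z<s)))
             (atLeast-prefix s u u≤n λ i i<u → s<t (suc i) (s≤s i<u)))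

All-lookup : ∀ {P : Pred ℕ 0ℓ} (s : Vec (Fin m) n) → All P (prefs s) → ∀ i → P (toℕ (lookup s i))
All-lookup (_ ∷ s) (p ∷ _)  zero    = p
All-lookup (_ ∷ s) (_ ∷ ps) (suc i) = All-lookup s ps i

lookup-All : ∀ {P : Pred ℕ 0ℓ} (s : Vec (Fin m) n) → (∀ i → P (toℕ (lookup s i))) → All P (prefs s)
lookup-All []      p = []
lookup-All (_ ∷ s) p = p zero ∷ lookup-All s (p ∘ suc)

toList-rearrange↑ : ∀ (x : Vec (Fin m) n) → toList (rearrange↑ x) ≡ Sort.sort (Fin.≤-decTotalOrder m) (toList x)
toList-rearrange↑ x = trans (Vec.toList-cast _ (fromList (sort (toList x)))) (Vec.toList∘fromList (sort (toList x)))
  where open Sort (Fin.≤-decTotalOrder _) using (sort)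

module _ {a r : ℕ} .{{_ : NonZero a}} where

  StairAt : Vec (Fin m) n → Fin n → Set
  StairAt s i = ∃[ c ] c ≤ toℕ i × c ≤ r × toℕ (lookup s i) ≡ c * a

  -- If the entry at place i were c a with c > i, all n - i entries from there on would be at least
  -- (i + 1) a, one more than `stairs` admits at u = i + 1.
  Stair⇒StairAt : ∀ (s : Vec (Fin m) n) → AllPairs _≤_ (prefs s) → Stair a r (prefs s) → ∀ i → StairAt s i
  Stair⇒StairAt {n = n} s s↗ (mk mult bdd stairs) i with divides c eq ← All-lookup s mult i =
    c , ≮⇒≥ i≮c , *-cancelʳ-≤ c r a (subst (_≤ r * a) eq (All-lookup s bdd i)) , eq
    where
    i≮c : ¬ toℕ i < c
    i≮c i<c = 1+n≰n (begin
      suc (length (prefs s))                              ≡⟨ cong suc (length-prefs s) ⟩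
      suc n                                               ≤⟨ s≤s (lookup-atLeast s s↗ i (≤-trans (*-monoˡ-≤ a i<c) (≤-reflexive (sym eq)))) ⟩
      suc (toℕ i) + atLeast (suc (toℕ i) * a) (prefs s)   ≤⟨ stairs (suc (toℕ i)) (subst (suc (toℕ i) ≤_) (sym (length-prefs s)) (Fin.toℕ<n i)) ⟩
      length (prefs s)                                    ∎)
      where open ≤-Reasoning

  -- The first u entries have coefficients below u and so are not counted at u a.
  StairAt⇒Stair : ∀ (s : Vec (Fin m) n) → (∀ i → StairAt s i) → Stair a r (prefs s)
  StairAt⇒Stair s at = mk
    (lookup-All s λ i → let c , _ , _ , eq = at i in divides c eq)
    (lookup-All s λ i → let c , _ , c≤r , eq = at i in ≤-trans (≤-reflexive eq) (*-monoˡ-≤ a c≤r))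
    (λ u u≤ → subst (u + atLeast (u * a) (prefs s) ≤_) (sym (length-prefs s))
      (atLeast-prefix s u (subst (u ≤_) (length-prefs s) u≤) λ i i<u →
        let c , c≤i , _ , eq = at i in subst (_< u * a) (sym eq) (*-monoˡ-< a (≤-<-trans c≤i i<u))))

  Stair⇔rearranged : ∀ (x : Vec (Fin m) n) → Stair a r (prefs x) ⇔ (∀ i → StairAt (rearrange↑ x) i)
  Stair⇔rearranged {m = m} x = mk⇔
    (λ st → Stair⇒StairAt (rearrange↑ x) sorted (Stair-↭ (↭-sym perm) st))
    (λ at → Stair-↭ perm (StairAt⇒Stair (rearrange↑ x) at))
    where
    open Sort (Fin.≤-decTotalOrder m) using (sort; sort-↭; sort-↗)
    perm : prefs (rearrange↑ x) ↭ prefs x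
    perm = Perm.map⁺ toℕ (subst (_↭ toList x) (sym (toList-rearrange↑ x)) (sort-↭ (toList x)))
    sorted : AllPairs _≤_ (prefs (rearrange↑ x))
    sorted = subst (λ xs → AllPairs _≤_ (map toℕ xs)) (sym (toList-rearrange↑ x))
                   (AllPairs.map⁺ (Linked⇒AllPairs ≤-trans (sort-↗ (toList x))))

-- Enumeration of the vectors satisfying Stair

HasCardinality-map : {P : Pred B 0ℓ} (f : A → B) (g : B → A) (xs : List A) → Unique xs →
  (∀ {x} → x ∈ˡ xs → g (f x) ≡ x × P (f x)) → (∀ {y} → P y → g y ∈ˡ xs × f (g y) ≡ y) →
  HasCardinality P (length xs)
HasCardinality-map {P = P} f g xs xs! to from = map f xs , map-unique {g = g} (proj₁ ∘ to) xs! , (λ y → mk⇔ ∈⇒P P⇒∈) , length-map f xs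
  where
  ∈⇒P : ∀ {y} → y ∈ˡ map f xs → P y
  ∈⇒P y∈ with _ , x∈ , refl ← ∈-map⁻ f y∈ = proj₂ (to x∈)
  P⇒∈ : ∀ {y} → P y → y ∈ˡ map f xs
  P⇒∈ Py = let gy∈ , eq = from Py in subst (_∈ˡ map f xs) eq (∈-map⁺ f gy∈)

Linked⇒AllPairs-prefs : ∀ {x : Vec (Fin m) n} → Linked Fin._≤_ x → AllPairs _≤_ (prefs x)
Linked⇒AllPairs-prefs []                       = []
Linked⇒AllPairs-prefs [-]                      = [] ∷ []
Linked⇒AllPairs-prefs {x = _ ∷ _ ∷ _} (p ∷ ps) with ps′@(q ∷ _) ← Linked⇒AllPairs-prefs ps =
  (p ∷ All.map (≤-trans p) q) ∷ ps′

AllPairs-prefs⇒Linked : ∀ {x : Vec (Fin m) n} → AllPairs _≤_ (prefs x) → Linked Fin._≤_ x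
AllPairs-prefs⇒Linked {x = []}        _               = []
AllPairs-prefs⇒Linked {x = _ ∷ []}    _               = [-]
AllPairs-prefs⇒Linked {x = _ ∷ _ ∷ _} ((p ∷ _) ∷ ps) = p ∷ AllPairs-prefs⇒Linked ps

AllPairs-reverse : ∀ {R : A → A → Set} {xs} → AllPairs R xs → AllPairs (flip R) (reverse xs)
AllPairs-reverse []                   = []
AllPairs-reverse {R = R} {x ∷ xs} (p ∷ ps) =
  subst (AllPairs (flip R)) (sym (unfold-reverse x xs))
        (AllPairs.++⁺ (AllPairs-reverse ps) ([] ∷ []) (All.map (_∷ []) (Perm.All-resp-↭ (↭-sym (Perm.↭-reverse xs)) p)))

-- Decreasing order makes the stair condition local. For v up to the head c, the head adds one to
-- count and length alike; for v > c no entry is counted.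
Descending⇒ : ∀ u {xs} → Descending u xs →
  All (_≤ u) xs × AllPairs _≥_ xs × (∀ v → v ≤ length xs → v + atLeast v xs ≤ length xs)
Descending⇒ u {[]}     _                = [] , [] , λ { zero _ → z≤n }
Descending⇒ u {c ∷ cs} (c≤u , c≤len , d) =
  let cs≤c , cs↘ , stairs = Descending⇒ c d in
  c≤u ∷ All.map (λ x≤c → ≤-trans x≤c c≤u) cs≤c , cs≤c ∷ cs↘ , stairs′ cs≤c stairs
  where
  stairs′ : All (_≤ c) cs → (∀ v → v ≤ length cs → v + atLeast v cs ≤ length cs) →
            ∀ v → v ≤ suc (length cs) → v + atLeast v (c ∷ cs) ≤ suc (length cs)
  stairs′ cs≤c stairs v v≤ with v ≤? c
  ... | yes v≤c = subst (λ z → v + z ≤ suc (length cs)) (sym (atLeast-accept cs v≤c))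
                        (subst (_≤ suc (length cs)) (sym (+-suc v _)) (s≤s (stairs v (≤-trans v≤c c≤len))))
  ... | no  v≰c = subst (λ z → v + z ≤ suc (length cs))
                        (sym (atLeast-none (≰⇒> v≰c ∷ All.map (λ x≤c → ≤-<-trans x≤c (≰⇒> v≰c)) cs≤c)))
                        (subst (_≤ suc (length cs)) (sym (+-identityʳ v)) v≤)

⇒Descending : ∀ u {xs} → All (_≤ u) xs → AllPairs _≥_ xs → (∀ v → v ≤ length xs → v + atLeast v xs ≤ length xs) → Descending u xs
⇒Descending u {[]}     _           _             _      = tt
⇒Descending u {c ∷ cs} (c≤u ∷ cs≤u) (cs≤c ∷ cs↘) stairs = c≤u , c≤len , ⇒Descending c cs≤c cs↘ stairs′
  where
  below-c : ∀ v → v ≤ c → v ≤ suc (length cs) → v + atLeast v cs ≤ length cs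
  below-c v v≤c v≤ = ≤-pred (subst (_≤ suc (length cs)) (trans (cong (λ z → v + z) (atLeast-accept cs v≤c)) (+-suc v _)) (stairs v v≤))
  c≤len : c ≤ length cs
  c≤len with c ≤? suc (length cs)
  ... | yes c≤ = ≤-trans (m≤m+n c _) (below-c c ≤-refl c≤)
  -- `stairs` ends at the length, so the length itself is tried; the head would be counted there,
  -- one too many.
  ... | no  c≰ = contradiction (≤-trans (m≤m+n (suc (length cs)) _) (below-c (suc (length cs)) (<⇒≤ (≰⇒> c≰)) ≤-refl)) 1+n≰n
  stairs′ : ∀ v → v ≤ length cs → v + atLeast v cs ≤ length cs
  stairs′ v v≤ with v ≤? c
  ... | yes v≤c = below-c v v≤c (m≤n⇒m≤1+n v≤)
  ... | no  v≰c = subst (λ z → v + z ≤ length cs) (sym (atLeast-none (All.map (λ x≤c → ≤-<-trans x≤c (≰⇒> v≰c)) cs≤c)))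
                        (subst (_≤ length cs) (sym (+-identityʳ v)) v≤)

module Units {m a r : ℕ} .{{_ : NonZero m}} .{{_ : NonZero a}} (ra<m : r * a < m) where

  -- Reduction mod m and padding by 0 make this total; on lists of length n with entries at most r
  -- it is plain multiplication by a, since r a < m.
  positions : ∀ n → List ℕ → Vec (Fin m) n
  positions zero    _        = []
  positions (suc n) []       = 0 mod m ∷ positions n []
  positions (suc n) (c ∷ cs) = (c * a) mod m ∷ positions n cs

  units : Vec (Fin m) n → List ℕ
  units x = map (_/ a) (prefs x)

  prefs-positions : ∀ n c → length c ≡ n → All (_≤ r) c → prefs (positions n c) ≡ map (_* a) c
  prefs-positions zero    []       _   _            = refl
  prefs-positions (suc n) (c ∷ cs) len (c≤r ∷ cs≤r) =
    cong₂ _∷_ (trans (Fin.toℕ-fromℕ< _) (m<n⇒m%n≡m (≤-<-trans (*-monoˡ-≤ a c≤r) ra<m)))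
              (prefs-positions n cs (suc-injective len) cs≤r)

  units-positions : ∀ n c → length c ≡ n → All (_≤ r) c → units (positions n c) ≡ c
  units-positions n c len c≤r =
    trans (cong (map (_/ a)) (prefs-positions n c len c≤r))
          (trans (sym (map-∘ c)) (map-id-local (All.universal (λ z → m*n/n≡m z a) c)))

  prefs-units : ∀ {x : Vec (Fin m) n} → All (a ∣_) (prefs x) → map (_* a) (units x) ≡ prefs x
  prefs-units {x = x} mult = trans (sym (map-∘ (prefs x))) (map-id-local (All.map m/n*n≡m mult))

  length-units : ∀ (x : Vec (Fin m) n) → length (units x) ≡ n
  length-units x = trans (length-map _ (prefs x)) (length-prefs x)

  units-bounded : ∀ {x : Vec (Fin m) n} → Stair a r (prefs x) → All (_≤ r) (units x)
  units-bounded {x = x} (mk mult bdd _) =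
    All.map (λ {z} za≤ra → *-cancelʳ-≤ z r a za≤ra) (All.map⁻ (subst (All (_≤ r * a)) (sym (prefs-units mult)) bdd))

  units-stairs : ∀ {x : Vec (Fin m) n} → Stair a r (prefs x) → ∀ v → v ≤ n → v + atLeast v (units x) ≤ n
  units-stairs {x = x} (mk mult _ stairs) v v≤n = subst₂ (λ c l → v + c ≤ l)
    (trans (cong (atLeast (v * a)) (sym (prefs-units mult))) (atLeast-scale a v (units x)))
    (length-prefs x)
    (stairs v (subst (v ≤_) (sym (length-prefs x)) v≤n))

  positions-units : ∀ {x : Vec (Fin m) n} → Stair a r (prefs x) → positions n (units x) ≡ x
  positions-units {n} {x} st = prefs-injective
    (trans (prefs-positions n (units x) (length-units x) (units-bounded st)) (prefs-units (Stair.multiples st)))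

  positions-Stair : ∀ {n c} → length c ≡ n → All (_≤ r) c → (∀ v → v ≤ n → v + atLeast v c ≤ n) → Stair a r (prefs (positions n c))
  positions-Stair {n} {c} refl c≤r stairs = subst (Stair a r) (sym (prefs-positions n c refl c≤r)) (mk
    (All.map⁺ (All.universal (λ z → n∣m*n z) c))
    (All.map⁺ (All.map (*-monoˡ-≤ a) c≤r))
    λ u u≤ → subst₂ (λ z l → u + z ≤ l) (sym (atLeast-scale a u c)) (sym (length-map _ c))
                    (stairs u (subst (u ≤_) (length-map _ c) u≤)))

  module _ {n} {P : Pred (Vec (Fin m) n) 0ℓ} (P⇔Stair : ∀ x → P x ⇔ Stair a r (prefs x)) where
    open module P⇔Stair {x} = Equivalence (P⇔Stair x)

    cardinality : r < n → HasCardinality P (length (boundedPFs (suc r) n))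
    cardinality r<n = HasCardinality-map (positions n) units (boundedPFs (suc r) n) (boundedPFs-unique (suc r) n) to′ from′
      where
      to′ : ∀ {c} → c ∈ˡ boundedPFs (suc r) n → units (positions n c) ≡ c × P (positions n c)
      to′ {c} c∈ with mk len c<1+r stair ← boundedPFs⁻ (suc r) n c∈ =
        units-positions n c len c≤r , from (positions-Stair len c≤r stairs)
        where
        c≤r = All.map ≤-pred c<1+r
        stairs : ∀ v → v ≤ n → v + atLeast v c ≤ n
        stairs v v≤n with v ≤? suc r
        ... | yes v≤1+r = subst (v + atLeast v c ≤_) len (stair v v≤1+r)
        -- The enumeration controls v only up to r + 1; beyond that no entry counts and v ≤ n is all
        -- that is claimed.
        ... | no  v≰1+r = subst (λ z → v + z ≤ n) (sym (atLeast-none (All.map (λ z< → <-trans z< (≰⇒> v≰1+r)) c<1+r)))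
                                (subst (_≤ n) (sym (+-identityʳ v)) v≤n)
      from′ : ∀ {x} → P x → units x ∈ˡ boundedPFs (suc r) n × positions n (units x) ≡ x
      from′ {x} Px = boundedPFs⁺ (suc r) n (mk (length-units x) (All.map s≤s (units-bounded st))
          λ v v≤1+r → subst (v + atLeast v (units x) ≤_) (sym (length-units x)) (units-stairs st v (≤-trans v≤1+r r<n)))
        , positions-units st
        where st = to Px

    cardinality↑ : HasCardinality (P ∩ Linked Fin._≤_) (length (descents n r))
    cardinality↑ = HasCardinality-map (positions n ∘ reverse) (reverse ∘ units) (descents n r) (descents-unique n r) to′ from′
      where
      to′ : ∀ {c} → c ∈ˡ descents n r → reverse (units (positions n (reverse c))) ≡ c ×
                                       (P ∩ Linked Fin._≤_) (positions n (reverse c))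
      to′ {c} c∈ with len , d ← descents⁻ n r c∈ with c≤r , c↘ , stairs ← Descending⇒ r d =
        trans (cong reverse (units-positions n (reverse c) len′ c≤r′)) (reverse-involutive c) ,
        from (positions-Stair len′ c≤r′ stairs′) ,
        AllPairs-prefs⇒Linked (subst (AllPairs _≤_) (sym (prefs-positions n (reverse c) len′ c≤r′))
          (AllPairs.map⁺ (AllPairs.map (*-monoˡ-≤ a) (AllPairs-reverse c↘))))
        where
        len′ = trans (length-reverse c) len
        c≤r′ = Perm.All-resp-↭ (↭-sym (Perm.↭-reverse c)) c≤r
        stairs′ : ∀ v → v ≤ n → v + atLeast v (reverse c) ≤ n
        stairs′ v v≤n = subst₂ (λ z l → v + z ≤ l) (Perm.↭-length (Perm.filter-↭ (v ≤?_) (↭-sym (Perm.↭-reverse c)))) len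
                               (stairs v (subst (v ≤_) (sym len) v≤n))
      from′ : ∀ {x} → (P ∩ Linked Fin._≤_) x → reverse (units x) ∈ˡ descents n r × positions n (reverse (reverse (units x))) ≡ x
      from′ {x} (Px , x↗) =
        descents⁺ n r len (⇒Descending r (Perm.All-resp-↭ (↭-sym (Perm.↭-reverse (units x))) (units-bounded st))
          (AllPairs-reverse units↗) stairs) ,
        trans (cong (positions n) (reverse-involutive (units x))) (positions-units st)
        where
        st = to Px
        len = trans (length-reverse (units x)) (length-units x)
        units↗ : AllPairs _≤_ (units x)
        units↗ = AllPairs.map (λ {y} {z} → *-cancelʳ-≤ y z a)
          (AllPairs.map⁻ (subst (AllPairs _≤_) (sym (prefs-units (Stair.multiples st))) (Linked⇒AllPairs-prefs x↗)))
        stairs : ∀ v → v ≤ length (reverse (units x)) → v + atLeast v (reverse (units x)) ≤ length (reverse (units x))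
        stairs v v≤ = subst₂ (λ z l → v + z ≤ l) (Perm.↭-length (Perm.filter-↭ (v ≤?_) (↭-sym (Perm.↭-reverse (units x))))) (sym len)
                             (units-stairs st v (subst (v ≤_) len v≤))

-- Necessity: counting free spots

extract : ∀ {z : A} (x : Vec A (suc N)) → z ∈ˡ toList x → ∃[ zs ] z ∷ toList {n = N} zs ↭ toList x
extract           (_ ∷ x) (here refl) = x , ↭-refl
extract {N = zero}  (_ ∷ []) (there ())
extract {N = suc _} {z} (y ∷ x) (there z∈) with zs , perm ← extract x z∈ =
  y ∷ zs , ↭-trans (swap z y ↭-refl) (prep y perm)

atLeast-∃ : ∀ (x : Vec (Fin m) n) → 0 < atLeast t (prefs x) → ∃[ z ] z ∈ˡ toList x × t ≤ toℕ z
atLeast-∃ {t = t} (y ∷ x) pos with t ≤? toℕ y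
... | yes t≤y = y , here refl , t≤y
... | no  t≰y = let z , z∈ , t≤z = atLeast-∃ x (subst (0 <_) (atLeast-reject (prefs x) (≰⇒> t≰y)) pos) in z , there z∈ , t≤z

atLeast-∄ : ∀ (x : Vec (Fin m) n) → atLeast t (prefs x) < n → ∃[ z ] z ∈ˡ toList x × toℕ z < t
atLeast-∄ {t = t} (y ∷ x) few with t ≤? toℕ y
... | no  t≰y = y , here refl , ≰⇒> t≰y
... | yes t≤y = let z , z∈ , z<t = atLeast-∄ x (≤-pred (subst (_< suc _) (atLeast-accept (prefs x) t≤y) few)) in z , there z∈ , z<t

Unique-lookup-injective : {xs : List A} → Unique xs → ∀ {i j} → List.lookup xs i ≡ List.lookup xs j → i ≡ j
Unique-lookup-injective (_  ∷ _)   {zero}  {zero}  _  = refl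
Unique-lookup-injective {xs = _ ∷ xs} (x∉ ∷ _)   {zero}  {suc j} eq = contradiction eq (All.lookup x∉ (∈-lookup {xs = xs} j))
Unique-lookup-injective {xs = _ ∷ xs} (x∉ ∷ _)   {suc i} {zero}  eq = contradiction (sym eq) (All.lookup x∉ (∈-lookup {xs = xs} i))
Unique-lookup-injective (_  ∷ xs!) {suc i} {suc j} eq = cong suc (Unique-lookup-injective xs! eq)

-- A certificate that at least k spots of [lo, hi) are free. Occupation is an arbitrary predicate,
-- without a decision procedure, so the spots are listed instead of counted.
Free : Pred (Fin m) 0ℓ → ℕ → ℕ → ℕ → Set
Free occ lo hi k = ∃[ ps ] Unique ps × All (λ p → p ∉ occ × lo ≤ toℕ p × toℕ p < hi) ps × length ps ≡ k

Free-none : Free occ lo hi 0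
Free-none = [] , [] , [] , refl

Free-⊆ : occ ⊆ occ′ → Free occ′ lo hi k → Free occ lo hi k
Free-⊆ occ⊆ (ps , ps! , free , len) = ps , ps! , All.map (λ (p∉ , bounds) → p∉ ∘ occ⊆ , bounds) free , len

-- Pigeonhole: the offsets from lo embed the listed spots into a set of size hi - lo.
Free-bound : lo ≤ hi → Free occ lo hi k → lo + k ≤ hi
Free-bound {lo = lo} {hi} lo≤hi (ps , ps! , free , refl) = begin
  lo + length ps   ≤⟨ +-monoʳ-≤ lo (Fin.injective⇒≤ {f = offset} (λ {i} {j} → injective {i} {j})) ⟩
  lo + (hi ∸ lo)   ≡⟨ m+[n∸m]≡n lo≤hi ⟩
  hi               ∎
  where
  open ≤-Reasoning
  within : ∀ i → lo ≤ toℕ (List.lookup ps i) × toℕ (List.lookup ps i) < hi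
  within i = proj₂ (All.lookup free (∈-lookup {xs = ps} i))
  bounds : ∀ i → toℕ (List.lookup ps i) ∸ lo < hi ∸ lo
  bounds i = ∸-monoˡ-< (proj₂ (within i)) (proj₁ (within i))
  offset : Fin (length ps) → Fin (hi ∸ lo)
  offset i = fromℕ< (bounds i)
  injective : ∀ {i j} → offset i ≡ offset j → i ≡ j
  injective {i} {j} eq = Unique-lookup-injective ps! (Fin.toℕ-injective
    (∸-cancelʳ-≡ (proj₁ (within i)) (proj₁ (within j)) (Fin.fromℕ<-injective _ _ (bounds i) (bounds j) eq)))

Block⁺ : ∀ {s p : Fin m} → toℕ s ≤ toℕ p → toℕ p < toℕ s + ℓ → p ∈ Block s ℓ
Block⁺ s≤p p<s+ℓ = s≤s s≤p , s≤s p<s+ℓ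

-- Parking read backwards: what is free after the car has parked was free before, and so was the
-- car's own block.
Free-Block : ∀ {s : Fin m} → s ∈ Fits occ ℓ → lo ≤ toℕ s → toℕ s + ℓ ≤ hi →
             Free (occ ∪ Block s ℓ) lo hi k → Free occ lo hi (ℓ + k)
Free-Block {m} {occ = occ} {ℓ} {lo} {hi} {s = s} (s+ℓ≤m , free-s) lo≤s s+ℓ≤hi (ps , ps! , free , refl) =
  block ++ ps , Unique.++⁺ block! ps! disjoint , All.++⁺ block-free (All.map (λ (p∉ , bounds) → p∉ ∘ inj₁ , bounds) free) ,
  trans (length-++ block) (cong (_+ length ps) (length-tabulate spotAt))
  where
  inStreet : ∀ (i : Fin ℓ) → toℕ s + toℕ i < m
  inStreet i = <-≤-trans (+-monoʳ-< (toℕ s) (Fin.toℕ<n i)) s+ℓ≤m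
  spotAt : Fin ℓ → Fin m
  spotAt i = fromℕ< (inStreet i)
  spotAt-toℕ : ∀ i → toℕ (spotAt i) ≡ toℕ s + toℕ i
  spotAt-toℕ i = Fin.toℕ-fromℕ< (inStreet i)
  spotAt∈ : ∀ i → spotAt i ∈ Block s ℓ
  spotAt∈ i = Block⁺ (subst (toℕ s ≤_) (sym (spotAt-toℕ i)) (m≤m+n (toℕ s) (toℕ i)))
                     (subst (_< toℕ s + ℓ) (sym (spotAt-toℕ i)) (+-monoʳ-< (toℕ s) (Fin.toℕ<n i)))
  block = tabulate spotAt
  block! : Unique block
  block! = Unique.tabulate⁺ λ {i} {j} eq →
    Fin.toℕ-injective (+-cancelˡ-≡ (toℕ s) (toℕ i) (toℕ j) (Fin.fromℕ<-injective _ _ (inStreet i) (inStreet j) eq))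
  block∈ : All (_∈ Block s ℓ) block
  block∈ = All.tabulate⁺ spotAt∈
  block-free : All (λ p → p ∉ occ × lo ≤ toℕ p × toℕ p < hi) block
  block-free = All.map (λ { {p} p∈@(s≤s s≤p , s≤s p<) → free-s p p∈ , ≤-trans lo≤s s≤p , <-≤-trans p< s+ℓ≤hi }) block∈
  disjoint : ∀ {p} → ¬ (p ∈ˡ block × p ∈ˡ ps)
  disjoint (p∈ , p∈′) = proj₁ (All.lookup free p∈′) (inj₂ (All.lookup block∈ p∈))

-- A car that prefers a spot from t on parks wholly behind t. Undoing the cars one by one, each of
-- these contributes a free spots.
atLeast-Free : ∀ {a} t (xs : Vec (Fin m) N) → AllPark occ (replicate N a) xs → Free occ t m (atLeast t (prefs xs) * a)
atLeast-Free t []       _ = Free-none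
atLeast-Free {a = a} t (x ∷ xs) (s , (x≤s , fits , _) , parks) with t ≤? toℕ x
... | yes t≤x = subst (λ c → Free _ t _ (c * a)) (sym (atLeast-accept (prefs xs) t≤x))
                      (Free-Block fits (≤-trans t≤x x≤s) (proj₁ fits) (atLeast-Free t xs parks))
... | no  t≰x = subst (λ c → Free _ t _ (c * a)) (sym (atLeast-reject (prefs xs) (≰⇒> t≰x)))
                      (Free-⊆ inj₁ (atLeast-Free t xs parks))

-- No later car straddles an occupied spot.
split-Free : ∀ {a} (p : Fin m) → p ∈ occ → (xs : Vec (Fin m) N) → AllPark occ (replicate N a) xs →
             ∃[ i ] ∃[ j ] i + j ≡ N × Free occ 0 (toℕ p) (i * a) × Free occ (toℕ p) m (j * a)
split-Free p p∈ []       _ = 0 , 0 , refl , Free-none , Free-none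
split-Free {a = a} p p∈ (x ∷ xs) (s , (_ , fits , _) , parks)
  with i , j , eq , left , right ← split-Free p (inj₁ p∈) xs parks | toℕ p <? toℕ s
... | yes p<s = i , suc j , trans (+-suc i j) (cong suc eq) , Free-⊆ inj₁ left , Free-Block fits (<⇒≤ p<s) (proj₁ fits) right
... | no  p≮s = suc i , j , cong suc eq ,
  -- Reaching past p would put the occupied p into the car's own block.
  Free-Block fits z≤n (≮⇒≥ λ p<s+a → proj₂ fits p (Block⁺ (≮⇒≥ p≮s) p<s+a) p∈) left , Free-⊆ inj₁ right

module Necessity {m N a b : ℕ} .{{_ : NonZero a}} .{{_ : NonZero b}} (m≡ : m ≡ b + N * a) where

  Street : Vec ℕ (suc N)
  Street = b ∷ replicate N a

  -- On an empty street fitting only means not running over the end. Since s fits and x ≤ s, so does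
  -- x.
  firstParks : ∀ {x s : Fin m} → ParksAt ∅ b x s → s ≡ x
  firstParks {x} (x≤s , fits , least) =
    Fin.toℕ-injective (≤-antisym (least x ≤-refl (≤-trans (+-monoˡ-≤ b x≤s) (proj₁ fits) , λ _ _ ())) x≤s)

  -- Two counts replace the tiling. With i cars in front of x and j behind, the front gives i a ≤ x
  -- and the back x + b + j a ≤ m; as m = b + (i + j) a, the latter reads x ≤ i a.
  first-multiple : ∀ {x} {xs : Vec (Fin m) N} → AllPark ∅ Street (x ∷ xs) → a ∣ toℕ x
  first-multiple {x} {xs} (s , parked , parks) with refl ← firstParks parked
    with i , j , i+j≡N , left , right ← split-Free x (inj₂ (Block⁺ ≤-refl (m<m+n (toℕ x) (>-nonZero⁻¹ b)))) xs parks =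
    divides i (≤-antisym x≤ia (Free-bound z≤n left))
    where
    fits = proj₁ (proj₂ parked)
    regroup : ∀ a b i j → b + (i + j) * a ≡ i * a + (b + j * a)
    regroup = ℕ-Solver.solve-∀
    x≤ia : toℕ x ≤ i * a
    x≤ia = +-cancelʳ-≤ (b + j * a) _ _ (begin
      toℕ x + (b + j * a)   ≤⟨ Free-bound (<⇒≤ (Fin.toℕ<n x)) (Free-Block fits ≤-refl (proj₁ fits) right) ⟩
      m                     ≡⟨ trans m≡ (cong (λ z → b + z * a) (sym i+j≡N)) ⟩
      b + (i + j) * a       ≡⟨ regroup a b i j ⟩
      i * a + (b + j * a)   ∎)
      where open ≤-Reasoning

  first-atLeast : ∀ {x} {xs : Vec (Fin m) N} → AllPark ∅ Street (x ∷ xs) →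
                  ∀ u → u * a ≤ toℕ x → u + atLeast (u * a) (prefs xs) ≤ N
  first-atLeast {x} {xs} (s , (x≤s , fits , _) , parks) u ua≤x =
    *-cancelʳ-≤ (u + c) N a (+-cancelˡ-≤ b _ _ (begin
      b + (u + c) * a       ≡⟨ regroup a b u c ⟩
      u * a + (b + c * a)   ≤⟨ Free-bound (≤-trans ua≤x (<⇒≤ (Fin.toℕ<n x)))
                                 (Free-Block fits (≤-trans ua≤x x≤s) (proj₁ fits) (atLeast-Free (u * a) xs parks)) ⟩
      m                     ≡⟨ m≡ ⟩
      b + N * a             ∎))
    where
    open ≤-Reasoning
    c = atLeast (u * a) (prefs xs)
    regroup : ∀ a b u c → b + (u + c) * a ≡ u * a + (b + c * a)
    regroup = ℕ-Solver.solve-∀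

  module _ {x : Vec (Fin m) (suc N)} (inv : ∀ x′ → toList x′ ↭ toList x → AllPark ∅ Street x′) where

    multiples : All (a ∣_) (prefs x)
    multiples = All.map⁺ (All.tabulate λ z∈ → let zs , perm = extract x z∈ in first-multiple (inv (_ ∷ zs) perm))

    stairs : ∀ u → u ≤ suc N → u + atLeast (u * a) (prefs x) ≤ suc N
    stairs u u≤ with atLeast (u * a) (prefs x) in eq
    ... | zero  = subst (_≤ suc N) (sym (+-identityʳ u)) u≤
    ... | suc c with z , z∈ , ua≤z ← atLeast-∃ {t = u * a} x (subst (0 <_) (sym eq) z<s)
                with zs , perm ← extract x z∈ =
      subst (_≤ suc N) (sym (+-suc u c)) (s≤s (subst (λ c → u + c ≤ N) (suc-injective count)
        (first-atLeast (inv (z ∷ zs) perm) u ua≤z)))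
      where
      count : suc (atLeast (u * a) (prefs zs)) ≡ suc c
      count = trans (sym (atLeast-accept (prefs zs) ua≤z))
                    (trans (Perm.↭-length (Perm.filter-↭ (u * a ≤?_) (Perm.map⁺ toℕ perm))) eq)

    stair-full : Stair a N (prefs x)
    stair-full = mk multiples (All.zipWith bound (multiples , All.tabulate small))
                    (subst (λ l → ∀ u → u ≤ l → u + atLeast (u * a) (prefs x) ≤ l) (sym (length-prefs x)) stairs)
      where
      bound : ∀ {z} → a ∣ z × z < suc N * a → z ≤ N * a
      bound (divides c refl , z<) = *-monoˡ-≤ a (≤-pred (*-cancelʳ-< a c (suc N) z<))
      small : ∀ {z} → z ∈ˡ prefs x → z < suc N * a
      -- At u = N + 1 the stair condition leaves no entry to be counted.
      small {z} z∈ = ≰⇒> λ large → 1+n≰n (≤-trans (m<m+n (suc N) (positive z∈ large)) (stairs (suc N) ≤-refl))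
        where
        positive : ∀ {z xs t} → z ∈ˡ xs → t ≤ z → 0 < atLeast t xs
        positive {xs = _ ∷ xs} (here refl) t≤z = subst (0 <_) (sym (atLeast-accept xs t≤z)) z<s
        positive {xs = y ∷ xs} (there z∈)  t≤z = <-≤-trans (positive z∈ t≤z) (atLeast-∷ _ y xs)

module BoundedNecessity {m N a b : ℕ} .{{_ : NonZero a}} .{{_ : NonZero b}} (m≡ : m ≡ b + suc N * a) where
  open Necessity {N = suc N} m≡

  -- The first car ends before z, so from z on only the end of the street can prevent parking, and z
  -- is no further along than s.
  after-first : ∀ {w z s : Fin m} → toℕ w ≡ 0 → b ≤ toℕ z → toℕ z ≤ toℕ s → s ∈ Fits (∅ ∪ Block w b) a →
                z ∈ Fits (∅ ∪ Block w b) a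
  after-first w≡0 b≤z z≤s fits = ≤-trans (+-monoˡ-≤ a z≤s) (proj₁ fits) , λ p → λ where
    (s≤s z≤p , _) (inj₂ (_ , s≤s p<w+b)) →
      <⇒≱ (subst (λ w → toℕ p < w + b) w≡0 p<w+b) (≤-trans b≤z z≤p)

  -- If the first car takes spots 1, …, b and the second one prefers a spot
  -- beyond them, then it gets that spot, and the gap in between has to be a
  -- multiple of a.
  second-aligned : ∀ {w z : Fin m} {ws : Vec (Fin m) N} → toℕ w ≡ 0 → b ≤ toℕ z → a ∣ toℕ z →
                   AllPark ∅ Street (w ∷ z ∷ ws) → a ∣ b
  second-aligned {w} {z} {ws} w≡0 b≤z a∣z (_ , parked , s , (z≤s , fits , least) , parks)
    with refl ← firstParks parked
    with refl ← Fin.toℕ-injective (≤-antisym (least z ≤-refl (after-first w≡0 b≤z z≤s fits)) z≤s)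
    with i , j , i+j≡N , left , right ← split-Free z (inj₂ (Block⁺ ≤-refl (m<m+n (toℕ z) (>-nonZero⁻¹ a)))) ws parks =
    ∣m+n∣m⇒∣n (subst (a ∣_) (≤-antisym z≤ia+b ia+b≤z) a∣z) (n∣m*n i)
    where
    first-fits = proj₁ (proj₂ parked)
    regroup : ∀ a b i j → b + (1 + (i + j)) * a ≡ i * a + b + (a + j * a)
    regroup = ℕ-Solver.solve-∀
    z≤ia+b : toℕ z ≤ i * a + b
    z≤ia+b = +-cancelʳ-≤ (a + j * a) _ _ (begin
      toℕ z + (a + j * a)          ≤⟨ Free-bound (<⇒≤ (Fin.toℕ<n z)) (Free-Block fits ≤-refl (proj₁ fits) right) ⟩
      m                            ≡⟨ trans m≡ (cong (λ z → b + suc z * a) (sym i+j≡N)) ⟩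
      b + suc (i + j) * a          ≡⟨ regroup a b i j ⟩
      i * a + b + (a + j * a)      ∎)
      where open ≤-Reasoning
    ia+b≤z : i * a + b ≤ toℕ z
    ia+b≤z = subst (_≤ toℕ z) (+-comm b (i * a))
      (Free-bound z≤n (Free-Block {lo = 0} first-fits z≤n (subst (λ w → w + b ≤ toℕ z) (sym w≡0) b≤z) (Free-⊆ inj₁ left)))

  module _ {x : Vec (Fin m) (2 + N)} (inv : ∀ x′ → toList x′ ↭ toList x → AllPark ∅ Street x′) where

    -- At most N + 1 of the N + 2 entries are at least a, and z is one of them. So another entry w
    -- is below a, hence 0, and invariance permits the order w, z, ..., to which `second-aligned`
    -- applies if b ≤ z.
    below-b : a ∤ b → ∀ {z} → z ∈ˡ toList x → a ≤ toℕ z → toℕ z < b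
    below-b a∤b {z} z∈ a≤z = ≰⇒> λ b≤z →
      let zs , z∷zs↭x = extract x z∈
          w , w∈ , w<a = atLeast-∄ {t = a} zs (few zs z∷zs↭x)
          ws , w∷ws↭zs = extract zs w∈
          perm = ↭-trans (↭-trans (swap w z ↭-refl) (prep z w∷ws↭zs)) z∷zs↭x
          parks = inv (w ∷ z ∷ ws) perm
      in a∤b (second-aligned (multiple-below (first-multiple parks) w<a) b≤z
                             (All.lookup (All.map⁻ (multiples inv)) z∈) parks)
      where
      multiple-below : ∀ {w} → a ∣ w → w < a → w ≡ 0
      multiple-below {zero}  _   _   = refl
      multiple-below {suc w} a∣w w<a = contradiction (∣⇒≤ a∣w) (<⇒≱ w<a)
      few : ∀ zs → z ∷ toList zs ↭ toList x → atLeast a (prefs zs) < suc N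
      few zs perm = ≤-pred (subst (λ c → suc c ≤ 2 + N) count
        (subst (λ t → suc (atLeast t (prefs x)) ≤ 2 + N) (*-identityˡ a) (stairs inv 1 (s≤s z≤n))))
        where
        count : atLeast a (prefs x) ≡ suc (atLeast a (prefs zs))
        count = trans (sym (Perm.↭-length (Perm.filter-↭ (a ≤?_) (Perm.map⁺ toℕ perm)))) (atLeast-accept (prefs zs) a≤z)

    stair-bounded : a ∤ b → Stair a (b / a) (prefs x)
    stair-bounded a∤b = mk mult (All.map⁺ (All.tabulate bound)) (Stair.stairs (stair-full inv))
      where
      mult = multiples inv
      bound : ∀ {z} → z ∈ˡ toList x → toℕ z ≤ b / a * a
      bound {z} z∈ with divides c eq ← All.lookup (All.map⁻ mult) z∈ = subst (_≤ b / a * a) (sym eq) (*-monoˡ-≤ a (c≤ c eq))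
        where
        c≤ : ∀ c → toℕ z ≡ c * a → c ≤ b / a
        -- The entry 0 is settled apart because `below-b` asks for a ≤ z.
        c≤ zero    _  = z≤n
        c≤ (suc c) eq = ≤-trans (≤-reflexive (sym (m*n/n≡m (suc c) a))) (/-monoˡ-≤ a (≤-trans (≤-reflexive (sym eq)) (<⇒≤ (below-b a∤b z∈ (≤-trans (m≤m+n a (c * a)) (≤-reflexive (sym eq)))))))

-- Sufficiency: a Hall condition on free slots

atLeast-mono : ∀ {t t′} xs → (∀ {x} → x ∈ˡ xs → t ≤ x → t′ ≤ x) → atLeast t xs ≤ atLeast t′ xs
atLeast-mono          []       imp = z≤n
atLeast-mono {t} {t′} (x ∷ xs) imp with t ≤? x
... | yes t≤x = subst₂ _≤_ (sym (atLeast-accept xs t≤x)) (sym (atLeast-accept xs (imp (here refl) t≤x)))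
                       (s≤s (atLeast-mono xs (imp ∘ there)))
... | no  t≰x = ≤-trans (≤-trans (≤-reflexive (atLeast-reject xs (≰⇒> t≰x))) (atLeast-mono xs (imp ∘ there))) (atLeast-∷ t′ x xs)

atLeast-antitone : ∀ {t t′} xs → t′ ≤ t → atLeast t xs ≤ atLeast t′ xs
atLeast-antitone xs t′≤t = atLeast-mono xs λ _ t≤x → ≤-trans t′≤t t≤x

atLeast-++ : ∀ t xs ys → atLeast t (xs ++ ys) ≡ atLeast t xs + atLeast t ys
atLeast-++ t xs ys = trans (cong length (filter-++ (t ≤?_) xs ys)) (length-++ (List.filter (t ≤?_) xs))

firstAtLeast : ∀ {t} F → 0 < atLeast t F → ∃[ F₁ ] ∃[ f ] ∃[ F₂ ] F ≡ F₁ ++ f ∷ F₂ × All (_< t) F₁ × t ≤ f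
firstAtLeast {t} (f ∷ F) pos with t ≤? f
... | yes t≤f = [] , f , F , refl , [] , t≤f
... | no  t≰f with F₁ , g , F₂ , refl , F₁<t , t≤g ← firstAtLeast F (subst (0 <_) (atLeast-reject F (≰⇒> t≰f)) pos) =
  f ∷ F₁ , g , F₂ , refl , ≰⇒> t≰f ∷ F₁<t , t≤g

AllPairs-remove : ∀ {R : A → A → Set} xs {y ys} → AllPairs R (xs ++ y ∷ ys) →
                  AllPairs R (xs ++ ys) × All (λ x → R x y) xs × All (R y) ys
AllPairs-remove []       (py ∷ ps) = ps , [] , py
AllPairs-remove (x ∷ xs) (px ∷ ps) =
  let ps′ , before , after = AllPairs-remove xs ps
      px₁ , px₂ = All.++⁻ xs px
  in All.++⁺ px₁ (All.tail px₂) ∷ ps′ , All.head px₂ ∷ before , after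

-- F lists the starting points of the free slots of length a.
record FreeSlots (a : ℕ) (occ : Pred (Fin m) 0ℓ) (F : List ℕ) (prefs : List ℕ) : Set where
  field
    separated : AllPairs (λ f g → f + a ≤ g) F
    inStreet  : All (λ f → f + a ≤ m) F
    covering  : ∀ p → p ∉ occ → ∃[ f ] f ∈ˡ F × f ≤ toℕ p × toℕ p < f + a
    available : ∀ {f} → f ∈ˡ F → ∀ p → f ≤ toℕ p → toℕ p < f + a → p ∉ occ
    aligned   : ∀ {f x} → f ∈ˡ F → x ∈ˡ prefs → f < x → f + a ≤ x
    hall      : ∀ t → atLeast t prefs ≤ atLeast t F

module _ {a : ℕ} .{{_ : NonZero a}} where

  0<a : 0 < a
  0<a = >-nonZero⁻¹ a

  -- The car takes the first free slot f ≥ x. By `aligned`, x is never strictly inside a free slot,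
  -- so cars fill whole slots and the remaining slots form the same structure for the remaining
  -- cars.
  parkAll : ∀ {F} (xs : Vec (Fin m) N) → FreeSlots a occ F (prefs xs) → AllPark occ (replicate N a) xs
  parkAll []       _  = tt
  parkAll {m} {occ = occ} {F} (x ∷ xs) st
    with F₁ , f , F₂ , refl , F₁<x , x≤f ← firstAtLeast F (<-≤-trans (subst (0 <_) (sym (atLeast-accept {toℕ x} (prefs xs) ≤-refl)) z<s)
                                                                   (FreeSlots.hall st (toℕ x))) = s , (x≤s , s-fits , least) , parkAll xs st′
    where
    open FreeSlots st
    f∈ : f ∈ˡ F₁ ++ f ∷ F₂
    f∈ = ∈-++⁺ʳ F₁ (here refl)
    f+a≤m : f + a ≤ m
    f+a≤m = All.lookup inStreet f∈
    s : Fin m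
    s = fromℕ< (<-≤-trans (m<m+n f 0<a) f+a≤m)
    s≡f : toℕ s ≡ f
    s≡f = Fin.toℕ-fromℕ< _
    removed = AllPairs-remove F₁ separated
    F₁-before : All (λ g → g + a ≤ f) F₁
    F₁-before = proj₁ (proj₂ removed)
    F₂-after : All (λ g → f + a ≤ g) F₂
    F₂-after = proj₂ (proj₂ removed)
    F₂≥f : All (f ≤_) F₂
    F₂≥f = All.map (≤-trans (m≤m+n f a)) F₂-after
    x≤s : toℕ x ≤ toℕ s
    x≤s = subst (toℕ x ≤_) (sym s≡f) x≤f
    s-fits : s ∈ Fits occ a
    s-fits = subst (λ z → z + a ≤ m) (sym s≡f) f+a≤m , λ p → λ where
      (s≤s s≤p , s≤s p<s+a) → available f∈ p (subst (_≤ toℕ p) s≡f s≤p) (subst (λ z → toℕ p < z + a) s≡f p<s+a)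
    -- Already the first spot of a place that fits is free, hence in some slot g. `aligned` excludes
    -- g < x, and f is the first slot from x on.
    least : ∀ t → toℕ x ≤ toℕ t → t ∈ Fits occ a → toℕ s ≤ toℕ t
    least t x≤t (_ , t-free) with g , g∈ , g≤t , t<g+a ← covering t (t-free t (Block⁺ ≤-refl (m<m+n (toℕ t) 0<a)))
      with toℕ x ≤? g
    ... | no  x≰g = contradiction (aligned g∈ (here refl) (≰⇒> x≰g)) (<⇒≱ (≤-<-trans x≤t t<g+a))
    ... | yes x≤g with ∈-++⁻ F₁ g∈
    ...   | inj₁ g∈F₁        = contradiction x≤g (<⇒≱ (All.lookup F₁<x g∈F₁))
    ...   | inj₂ (here refl) = ≤-trans (≤-reflexive s≡f) g≤t
    ...   | inj₂ (there g∈F₂) = ≤-trans (≤-reflexive s≡f) (≤-trans (All.lookup F₂≥f g∈F₂) g≤t)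
    keep : ∀ {g} → g ∈ˡ F₁ ++ F₂ → g ∈ˡ F₁ ++ f ∷ F₂
    keep g∈ with ∈-++⁻ F₁ g∈
    ... | inj₁ g∈F₁ = ∈-++⁺ˡ g∈F₁
    ... | inj₂ g∈F₂ = ∈-++⁺ʳ F₁ (there g∈F₂)
    covering′ : ∀ p → p ∉ occ ∪ Block s a → ∃[ g ] g ∈ˡ F₁ ++ F₂ × g ≤ toℕ p × toℕ p < g + a
    covering′ p p∉ with g , g∈ , g≤p , p<g+a ← covering p (p∉ ∘ inj₁) with ∈-++⁻ F₁ g∈
    ... | inj₁ g∈F₁         = g , ∈-++⁺ˡ g∈F₁ , g≤p , p<g+a
    ... | inj₂ (there g∈F₂) = g , ∈-++⁺ʳ F₁ g∈F₂ , g≤p , p<g+a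
    ... | inj₂ (here refl)  = contradiction
      (inj₂ (Block⁺ (subst (_≤ toℕ p) (sym s≡f) g≤p) (subst (λ z → toℕ p < z + a) (sym s≡f) p<g+a))) p∉
    available′ : ∀ {g} → g ∈ˡ F₁ ++ F₂ → ∀ p → g ≤ toℕ p → toℕ p < g + a → p ∉ occ ∪ Block s a
    available′ g∈ p g≤p p<g+a (inj₁ p∈) = available (keep g∈) p g≤p p<g+a p∈
    available′ g∈ p g≤p p<g+a (inj₂ (s≤s s≤p , s≤s p<s+a)) with ∈-++⁻ F₁ g∈
    ... | inj₁ g∈F₁ = <⇒≱ (<-≤-trans p<g+a (All.lookup F₁-before g∈F₁)) (subst (_≤ toℕ p) s≡f s≤p)
    ... | inj₂ g∈F₂ = <⇒≱ (subst (λ z → toℕ p < z + a) s≡f p<s+a) (≤-trans (All.lookup F₂-after g∈F₂) g≤p)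
    hall-split : ∀ t → atLeast t (prefs (x ∷ xs)) ≤ atLeast t F₁ + atLeast t (f ∷ F₂)
    hall-split t = subst (atLeast t (prefs (x ∷ xs)) ≤_) (atLeast-++ t F₁ (f ∷ F₂)) (hall t)
    -- Removing x and f keeps Hall's condition. For t ≤ x both counts fall by one. For x ≤ t ≤ f no
    -- free slot starts between x and f, so all of F₂ counts at t as it does at x, and the case t =
    -- x suffices.
    drop-f : ∀ t → t ≤ f → toℕ x ≤ t ⊎ t ≤ toℕ x → atLeast t (prefs xs) ≤ atLeast t F₁ + atLeast t F₂
    drop-f t t≤f (inj₂ t≤x) = ≤-pred (begin
      suc (atLeast t (prefs xs))               ≡⟨ sym (atLeast-accept (prefs xs) t≤x) ⟩
      atLeast t (prefs (x ∷ xs))               ≤⟨ hall-split t ⟩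
      atLeast t F₁ + atLeast t (f ∷ F₂)        ≡⟨ cong (λ z → atLeast t F₁ + z) (atLeast-accept F₂ t≤f) ⟩
      atLeast t F₁ + suc (atLeast t F₂)        ≡⟨ +-suc _ _ ⟩
      suc (atLeast t F₁ + atLeast t F₂)        ∎)
      where open ≤-Reasoning
    drop-f t t≤f (inj₁ x≤t) = begin
      atLeast t (prefs xs)                     ≤⟨ atLeast-antitone (prefs xs) x≤t ⟩
      atLeast (toℕ x) (prefs xs)               ≤⟨ drop-f (toℕ x) x≤f (inj₂ ≤-refl) ⟩
      atLeast (toℕ x) F₁ + atLeast (toℕ x) F₂  ≡⟨ cong (_+ atLeast (toℕ x) F₂) (atLeast-none F₁<x) ⟩
      atLeast (toℕ x) F₂                       ≤⟨ length-filter (toℕ x ≤?_) F₂ ⟩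
      length F₂                                ≡⟨ sym (atLeast-all (All.map (≤-trans t≤f) F₂≥f)) ⟩
      atLeast t F₂                             ≤⟨ m≤n+m _ _ ⟩
      atLeast t F₁ + atLeast t F₂              ∎
      where open ≤-Reasoning
    hall′ : ∀ t → atLeast t (prefs xs) ≤ atLeast t (F₁ ++ F₂)
    hall′ t = subst (atLeast t (prefs xs) ≤_) (sym (atLeast-++ t F₁ F₂)) (case (t ≤? f))
      where
      case : Dec (t ≤ f) → atLeast t (prefs xs) ≤ atLeast t F₁ + atLeast t F₂
      case (yes t≤f) = drop-f t t≤f (≤-total (toℕ x) t)
      case (no  t≰f) = ≤-trans (atLeast-∷ t (toℕ x) (prefs xs))
        (≤-trans (hall-split t) (≤-reflexive (cong (λ z → atLeast t F₁ + z) (atLeast-reject F₂ (≰⇒> t≰f)))))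
    st′ : FreeSlots a (occ ∪ Block s a) (F₁ ++ F₂) (prefs xs)
    st′ = record
      { separated = proj₁ removed
      ; inStreet  = let in₁ , in₂ = All.++⁻ F₁ inStreet in All.++⁺ in₁ (All.tail in₂)
      ; covering  = covering′
      ; available = available′
      ; aligned   = λ f∈ x∈ → aligned (keep f∈) (there x∈)
      ; hall      = hall′
      }

  -- As slots start only at the values of f, it is enough to test Hall's condition just above each
  -- start: if f i < t ≤ f (i + 1), then N - i - 1 slots are left, and the entries from t on all
  -- exceed f i.
  hall-applyUpTo : ∀ (f : ℕ → ℕ) N xs {t} → (∀ {i j} → i ≤ j → f i ≤ f j) →
    (∀ i → i < N → suc i + atLeast (suc (f i)) xs ≤ N) → atLeast t xs ≤ N → atLeast t xs ≤ atLeast t (applyUpTo f N)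
  hall-applyUpTo f zero    xs mono few all = all
  hall-applyUpTo f (suc N) xs {t} mono few all with t ≤? f 0
  ... | yes t≤f0 = subst (atLeast t xs ≤_) (sym (trans (atLeast-all (All.applyUpTo⁺₂ f (suc N) λ i → ≤-trans t≤f0 (mono z≤n)))
                                                       (length-applyUpTo f (suc N)))) all
  ... | no  t≰f0 = subst (atLeast t xs ≤_) (sym (atLeast-reject _ (≰⇒> t≰f0)))
    (hall-applyUpTo (f ∘ suc) N xs (mono ∘ s≤s) (λ i i<N → ≤-pred (few (suc i) (s≤s i<N)))
      (≤-trans (atLeast-antitone xs (≰⇒> t≰f0)) (≤-pred (few 0 z<s))))

  multiples-gap : ∀ {f x} → a ∣ f → a ∣ x → f < x → f + a ≤ x
  multiples-gap (divides c refl) (divides d refl) f<x =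
    subst (_≤ d * a) (+-comm a (c * a)) (*-monoˡ-≤ a (*-cancelʳ-< a c d f<x))

  module _ {m N b r : ℕ} .{{_ : NonZero b}} (m≡ : m ≡ b + N * a) where

    -- The alternative at the end controls the slots behind the first car. If a divides b, they
    -- start at multiples of a like the preferences; otherwise they start at b or later, and no
    -- preference lies beyond that.
    stair-parks : ∀ {x : Vec (Fin m) (suc N)} → r ≤ N → Stair a r (prefs x) → (a ∣ b) ⊎ All (_≤ b) (prefs x) →
                  AllPark ∅ (b ∷ replicate N a) x
    stair-parks {x₀ ∷ xs} r≤N (mk (divides k x₀≡ka ∷ mult) (x₀≤ra ∷ _) stairs) choice =
      x₀ , (≤-refl , fits , λ _ x₀≤t _ → x₀≤t) , parkAll xs st
      where
      k≤N : k ≤ N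
      k≤N = ≤-trans (*-cancelʳ-≤ k r a (subst (_≤ r * a) x₀≡ka x₀≤ra)) r≤N
      fits : x₀ ∈ Fits ∅ b
      fits = (begin
        toℕ x₀ + b   ≡⟨ trans (+-comm (toℕ x₀) b) (cong (λ z → b + z) x₀≡ka) ⟩
        b + k * a    ≤⟨ +-monoʳ-≤ b (*-monoˡ-≤ a k≤N) ⟩
        b + N * a    ≡⟨ sym m≡ ⟩
        m            ∎) , λ _ _ ()
        where open ≤-Reasoning
      -- The k slots before the first car and the N - k slots behind it.
      shift slot : ℕ → ℕ
      shift i with i <? k
      ... | yes _ = 0
      ... | no  _ = b
      slot i = i * a + shift i
      slot-before : ∀ {i} → i < k → slot i ≡ i * a
      slot-before {i} i<k with i <? k
      ... | yes _   = +-identityʳ (i * a)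
      ... | no  i≮k = contradiction i<k i≮k
      slot-after : ∀ {i} → k ≤ i → slot i ≡ i * a + b
      slot-after {i} k≤i with i <? k
      ... | yes i<k = contradiction k≤i (<⇒≱ i<k)
      ... | no  _   = refl
      shift-mono : ∀ {i j} → i ≤ j → shift i ≤ shift j
      shift-mono {i} {j} i≤j with i <? k | j <? k
      ... | yes _   | _       = z≤n
      ... | no  i≮k | yes j<k = contradiction (≤-<-trans i≤j j<k) i≮k
      ... | no  _   | no  _   = ≤-refl
      shift≤b : ∀ i → shift i ≤ b
      shift≤b i with i <? k
      ... | yes _ = z≤n
      ... | no  _ = ≤-refl
      slot-mono : ∀ {i j} → i ≤ j → slot i ≤ slot j
      slot-mono i≤j = +-mono-≤ (*-monoˡ-≤ a i≤j) (shift-mono i≤j)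
      next-slot : ∀ i s → i * a + s + a ≡ suc i * a + s
      next-slot i s = regroup a i s
        where
        regroup : ∀ a i s → i * a + s + a ≡ (1 + i) * a + s
        regroup = ℕ-Solver.solve-∀
      separated : ∀ {i j} → i < j → slot i + a ≤ slot j
      separated {i} {j} i<j = ≤-trans (≤-reflexive (next-slot i (shift i)))
                                      (+-mono-≤ (*-monoˡ-≤ a i<j) (shift-mono (<⇒≤ i<j)))
      inStreet : ∀ {i} → i < N → slot i + a ≤ m
      inStreet {i} i<N = begin
        slot i + a           ≡⟨ next-slot i (shift i) ⟩
        suc i * a + shift i  ≤⟨ +-mono-≤ (*-monoˡ-≤ a i<N) (shift≤b i) ⟩
        N * a + b            ≡⟨ +-comm (N * a) b ⟩
        b + N * a            ≡⟨ sym m≡ ⟩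
        m                    ∎
        where open ≤-Reasoning
      F = applyUpTo slot N
      slot∈ : ∀ {i p} → i < N → slot i ≤ p → p < slot i + a → ∃[ f ] f ∈ˡ F × f ≤ p × p < f + a
      slot∈ i<N le lt = _ , ∈-applyUpTo⁺ slot i<N , le , lt
      p<[p/a]a+a : ∀ p → p < p / a * a + a
      p<[p/a]a+a p = subst₂ _<_ (sym (m≡m%n+[m/n]*n p a)) (+-comm a (p / a * a)) (+-monoˡ-< (p / a * a) (m%n<n p a))
      covering : ∀ p → p ∉ ∅ ∪ Block x₀ b → ∃[ f ] f ∈ˡ F × f ≤ toℕ p × toℕ p < f + a
      covering p p∉ with toℕ p <? toℕ x₀
      ... | yes p<x₀ = slot∈ (<-≤-trans i<k k≤N) (≤-trans (≤-reflexive (slot-before i<k)) (m/n*n≤m (toℕ p) a))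
                             (<-≤-trans (p<[p/a]a+a (toℕ p)) (≤-reflexive (cong (_+ a) (sym (slot-before i<k)))))
        where
        i<k : toℕ p / a < k
        i<k = m<n*o⇒m/o<n (subst (toℕ p <_) x₀≡ka p<x₀)
      ... | no  p≮x₀ = slot∈ i<N (≤-trans (≤-reflexive (slot-after k≤i))
                                   (subst (q / a * a + b ≤_) (m∸n+n≡m b≤p) (+-monoˡ-≤ b (m/n*n≤m q a))))
          (subst₂ _<_ (m∸n+n≡m b≤p) (trans (swap-last (q / a * a) a b) (cong (_+ a) (sym (slot-after k≤i))))
                  (+-monoˡ-< b (p<[p/a]a+a q)))
        where
        swap-last : ∀ x y z → x + y + z ≡ x + z + y
        swap-last = ℕ-Solver.solve-∀
        -- Cutting out the b spots of the first car makes the slots behind it ordinary multiples of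
        -- a.
        q = toℕ p ∸ b
        x₀+b≤p : toℕ x₀ + b ≤ toℕ p
        x₀+b≤p = ≮⇒≥ λ p< → p∉ (inj₂ (Block⁺ (≮⇒≥ p≮x₀) p<))
        b≤p : b ≤ toℕ p
        b≤p = m+n≤o⇒n≤o (toℕ x₀) x₀+b≤p
        k≤i : k ≤ q / a
        k≤i = ≤-trans (≤-reflexive (sym (m*n/n≡m k a)))
                      (/-monoˡ-≤ a (subst (_≤ q) x₀≡ka (m+n≤o⇒m≤o∸n (toℕ x₀) x₀+b≤p)))
        i<N : q / a < N
        i<N = m<n*o⇒m/o<n (+-cancelʳ-< b q (N * a)
          (subst₂ _<_ (sym (m∸n+n≡m b≤p)) (trans m≡ (+-comm b (N * a))) (Fin.toℕ<n p)))
      available : ∀ {f} → f ∈ˡ F → ∀ p → f ≤ toℕ p → toℕ p < f + a → p ∉ ∅ ∪ Block x₀ b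
      available f∈ p f≤p p<f+a (inj₂ (s≤s x₀≤p , s≤s p<x₀+b)) with i , i<N , refl ← ∈-applyUpTo⁻ slot f∈ with i <? k
      ... | yes i<k = <⇒≱ (begin-strict
            toℕ p       <⟨ p<f+a ⟩
            i * a + 0 + a ≡⟨ trans (next-slot i 0) (+-identityʳ (suc i * a)) ⟩
            suc i * a   ≤⟨ *-monoˡ-≤ a i<k ⟩
            k * a       ≡⟨ sym x₀≡ka ⟩
            toℕ x₀      ∎) x₀≤p
        where open ≤-Reasoning
      ... | no  i≮k = <⇒≱ p<x₀+b (≤-trans (+-monoˡ-≤ b (≤-trans (≤-reflexive x₀≡ka) (*-monoˡ-≤ a (≮⇒≥ i≮k)))) f≤p)
      aligned : ∀ {f x} → f ∈ˡ F → x ∈ˡ prefs xs → f < x → f + a ≤ x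
      aligned {x = x} f∈ x∈ f<x with i , i<N , refl ← ∈-applyUpTo⁻ slot f∈ = case (i <? k) choice
        where
        case : Dec (i < k) → (a ∣ b) ⊎ All (_≤ b) (prefs (x₀ ∷ xs)) → slot i + a ≤ x
        case (yes i<k) _ = multiples-gap (subst (a ∣_) (sym (slot-before i<k)) (n∣m*n i)) (All.lookup mult x∈) f<x
        case (no  i≮k) (inj₁ a∣b) = multiples-gap (subst (a ∣_) (sym (slot-after (≮⇒≥ i≮k))) (∣m∣n⇒∣m+n (n∣m*n i) a∣b))
                                                  (All.lookup mult x∈) f<x
        case (no  i≮k) (inj₂ (_ ∷ xs≤b)) = contradiction
          (≤-trans (All.lookup xs≤b x∈) (≤-trans (m≤n+m b (i * a)) (≤-reflexive (sym (slot-after (≮⇒≥ i≮k)))))) (<⇒≱ f<x)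
      len = length-prefs xs
      stairs′ : ∀ u → u ≤ suc N → u + atLeast (u * a) (prefs (x₀ ∷ xs)) ≤ suc N
      stairs′ u u≤ = subst (u + atLeast (u * a) (prefs (x₀ ∷ xs)) ≤_) (cong suc len) (stairs u (subst (u ≤_) (sym (cong suc len)) u≤))
      few : ∀ i → i < N → suc i + atLeast (suc (slot i)) (prefs xs) ≤ N
      few i i<N = case (i <? k) choice
        where
        case : Dec (i < k) → (a ∣ b) ⊎ All (_≤ b) (prefs (x₀ ∷ xs)) → suc i + atLeast (suc (slot i)) (prefs xs) ≤ N
        -- The first entry k a is itself counted at (i + 1) a, which leaves one less for the others.
        case (yes i<k) _ = begin
          suc i + atLeast (suc (slot i)) (prefs xs)
            ≤⟨ +-monoʳ-≤ (suc i) (atLeast-mono (prefs xs) λ {x} x∈ i< → subst (_≤ x) (+-comm (i * a) a)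
                 (multiples-gap (n∣m*n i) (All.lookup mult x∈) (subst (_< x) (slot-before i<k) i<))) ⟩
          suc i + atLeast (suc i * a) (prefs xs)
            ≤⟨ ≤-pred (subst (_≤ suc N) (trans (cong (λ z → suc i + z) (atLeast-accept (prefs xs) si≤x₀)) (+-suc (suc i) _))
                             (stairs′ (suc i) (m≤n⇒m≤1+n i<N))) ⟩
          N ∎
          where
          open ≤-Reasoning
          si≤x₀ : suc i * a ≤ toℕ x₀
          si≤x₀ = subst (suc i * a ≤_) (sym x₀≡ka) (*-monoˡ-≤ a i<k)
        -- Since a ≤ b, a multiple of a beyond i a + b is at least (i + 2) a, so the stair condition
        -- is taken at i + 2.
        case (no i≮k) (inj₁ a∣b) = ≤-pred (begin
          suc (suc i) + atLeast (suc (slot i)) (prefs xs)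
            ≤⟨ +-monoʳ-≤ (2 + i) (atLeast-mono (prefs xs) λ {x} x∈ i< → beyond (All.lookup mult x∈) (subst (_< x) (slot-after (≮⇒≥ i≮k)) i<)) ⟩
          suc (suc i) + atLeast ((2 + i) * a) (prefs xs)
            ≤⟨ +-monoʳ-≤ (2 + i) (atLeast-∷ ((2 + i) * a) (toℕ x₀) (prefs xs)) ⟩
          suc (suc i) + atLeast ((2 + i) * a) (prefs (x₀ ∷ xs))
            ≤⟨ stairs′ (2 + i) (s≤s i<N) ⟩
          suc N ∎)
          where
          open ≤-Reasoning
          beyond : ∀ {x} → a ∣ x → i * a + b < x → (2 + i) * a ≤ x
          beyond {x} a∣x lt = subst (_≤ x) (trans (next-slot i a) (+-comm (suc i * a) a))
            (multiples-gap (∣m∣n⇒∣m+n (n∣m*n i) ∣-refl) a∣x (≤-<-trans (+-monoʳ-≤ (i * a) (∣⇒≤ a∣b)) lt))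
        -- The slot starts at b or later, so no preference exceeds its start.
        case (no i≮k) (inj₂ (_ ∷ xs≤b)) = subst (_≤ N) (sym (trans (cong (λ z → suc i + z)
          (atLeast-none (All.map (λ x≤b → s≤s (≤-trans x≤b (≤-trans (m≤n+m b (i * a)) (≤-reflexive (sym (slot-after (≮⇒≥ i≮k))))))) xs≤b)))
          (+-identityʳ (suc i)))) i<N
      st : FreeSlots a (∅ ∪ Block x₀ b) F (prefs xs)
      st = record
        { separated = AllPairs.applyUpTo⁺₁ slot N λ i<j _ → separated i<j
        ; inStreet  = All.applyUpTo⁺₁ slot N inStreet
        ; covering  = covering
        ; available = available
        ; aligned   = aligned
        ; hall      = λ t → hall-applyUpTo slot N (prefs xs) slot-mono few
                              (subst (atLeast t (prefs xs) ≤_) len (length-filter (t ≤?_) (prefs xs)))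
        }

-- Assembling the theorem

sum-replicate : ∀ N a → sum (replicate N a) ≡ N * a
sum-replicate zero    a = refl
sum-replicate (suc N) a = cong (_+_ a) (sum-replicate N a)

-- Fractions in `ℚ` are kept in lowest terms. Among unnormalised fractions the equation is the cross
-- multiplication `eq`.
ℕ-ratio : ∀ c p d n → suc n * c ≡ p * d → (+ c) ℚ./ 1 ≡ ((+ p) ℚ./ suc n) ℚ.* ((+ d) ℚ./ 1)
ℕ-ratio c p d n eq = ℚ.toℚᵘ-injective (begin
  ℚ.toℚᵘ ((+ c) ℚ./ 1)                                         ≈⟨ ℚ.toℚᵘ-fromℚᵘ (mkℚᵘ (+ c) 0) ⟩
  mkℚᵘ (+ c) 0                                                 ≈⟨ *≡* cross ⟩
  mkℚᵘ (+ p) n ℚᵘ.* mkℚᵘ (+ d) 0                               ≈⟨ ℚᵘ.*-cong (ℚ.toℚᵘ-fromℚᵘ (mkℚᵘ (+ p) n)) (ℚ.toℚᵘ-fromℚᵘ (mkℚᵘ (+ d) 0)) ⟨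
  ℚ.toℚᵘ ((+ p) ℚ./ suc n) ℚᵘ.* ℚ.toℚᵘ ((+ d) ℚ./ 1)           ≈⟨ ℚ.toℚᵘ-homo-* ((+ p) ℚ./ suc n) ((+ d) ℚ./ 1) ⟨
  ℚ.toℚᵘ (((+ p) ℚ./ suc n) ℚ.* ((+ d) ℚ./ 1))                 ∎)
  where
  open ℚᵘ.≃-Reasoning
  cross : + c ℤ.* + (suc n * 1) ≡ + p ℤ.* + d ℤ.* + 1
  cross = trans (sym (ℤ.pos-* c (suc n * 1))) (trans (cong +_ (trans (cong (c *_) (*-identityʳ (suc n))) (trans (*-comm c (suc n)) eq)))
          (trans (ℤ.pos-* p d) (sym (ℤ.*-identityʳ (+ p ℤ.* + d)))))

Progression⁺ : ∀ {a c j v} → c < j → v ≡ c * a → suc v ∈ Progression a j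
Progression⁺ {c = c} c<j eq = suc c , s≤s z≤n , c<j , cong suc eq

Progression⁻ : ∀ {a j v} → suc v ∈ Progression a j → ∃[ c ] c < j × v ≡ c * a
Progression⁻ (suc c , _ , c<j , eq) = c , c<j , suc-injective eq

module Street (N a b : ℕ) .{{_ : NonZero a}} .{{_ : NonZero b}} where

  cars spots : ℕ
  cars = 2 + N
  spots = sum (lengths cars a b)

  m≡ : spots ≡ b + suc N * a
  m≡ = cong (_+_ b) (sum-replicate (suc N) a)

  instance
    spots≢0 : NonZero spots
    spots≢0 = >-nonZero (<-≤-trans (>-nonZero⁻¹ b) (m≤m+n b _))

  street-bound : ∀ {r} → r ≤ suc N → r * a < spots
  street-bound {r} r≤ = subst (r * a <_) (sym m≡) (≤-<-trans (*-monoˡ-≤ a r≤) (m<n+m _ (>-nonZero⁻¹ b)))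

  sufficient : ∀ {r} → r ≤ suc N → (a ∣ b) ⊎ r * a ≤ b → ∀ {x} → Stair a r (prefs x) → x ∈ PAinv (lengths cars a b)
  sufficient {r} r≤ choice {x} st x′ perm = stair-parks {r = r} m≡ r≤ st′ (decide choice)
    where
    st′ = Stair-↭ (Perm.map⁺ toℕ (↭-sym perm)) st
    decide : (a ∣ b) ⊎ r * a ≤ b → (a ∣ b) ⊎ All (_≤ b) (prefs x′)
    decide (inj₁ a∣b)  = inj₁ a∣b
    decide (inj₂ ra≤b) = inj₂ (All.map (λ x≤ra → ≤-trans x≤ra ra≤b) (Stair.bounded st′))

  module Unbounded (choice : (a ∣ b) ⊎ b > suc N * a) where

    PAinv⇔Stair : ∀ x → x ∈ PAinv (lengths cars a b) ⇔ Stair a (suc N) (prefs x)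
    PAinv⇔Stair x = mk⇔ (λ inv → Necessity.stair-full m≡ inv) (sufficient ≤-refl (weaken choice))
      where
      weaken : (a ∣ b) ⊎ b > suc N * a → (a ∣ b) ⊎ suc N * a ≤ b
      weaken (inj₁ a∣b) = inj₁ a∣b
      weaken (inj₂ <b)  = inj₂ (<⇒≤ <b)

    characterisation : ∀ x → x ∈ PAinv (lengths cars a b) ⇔ (∀ i → orderStatistic x i ∈ Progression a (spot i))
    characterisation x = mk⇔
      (λ inv i → let c , c≤i , _ , eq = to (Stair⇔rearranged x) (to (PAinv⇔Stair x) inv) i in Progression⁺ (s≤s c≤i) eq)
      (λ prog → from (PAinv⇔Stair x) (from (Stair⇔rearranged x) λ i →
        let c , c<1+i , eq = Progression⁻ (prog i) in c , ≤-pred c<1+i , ≤-pred (<-≤-trans c<1+i (Fin.toℕ<n i)) , eq))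
      where open Equivalence

    count : HasCardinality (PAinv (lengths cars a b)) ((cars + 1) ^ (cars ∸ 1))
    count = subst (HasCardinality _) (ℤ.+-injective (fullCount boundedPFs-recursion (suc N)))
                  (Units.cardinality (street-bound ≤-refl) PAinv⇔Stair ≤-refl)

    count↑ : ∃[ c ] HasCardinality (PAinv↑ (lengths cars a b)) c
                  × (+ c) ℚ./ 1 ≡ ((+ 1) ℚ./ suc cars) ℚ.* ((+ ((2 * cars) C cars)) ℚ./ 1)
    count↑ = length (descents cars (suc N)) , Units.cardinality↑ (street-bound ≤-refl) PAinv⇔Stair ,
      ℕ-ratio (length (descents cars (suc N))) 1 ((2 * cars) C cars) cars (begin
        suc cars * length (descents cars (suc N))   ≡⟨ cong (λ z → suc cars * z) (sym no-larger) ⟩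
        suc cars * length (descents cars cars)         ≡⟨ ballot (≤-refl {cars}) ⟩
        (cars ∸ cars + 1) * ((cars + cars) C cars)           ≡⟨ cong₂ (λ x y → (x + 1) * (y C cars)) (n∸n≡0 cars) (sym (cong (_+_ cars) (+-identityʳ cars))) ⟩
        1 * ((2 * cars) C cars)                     ∎)
      where
      open ≡-Reasoning
      -- No entry exceeds n - 1, so the bound may be raised to n, where the ballot factor becomes 1
      -- and the binomial coefficient the central one.
      no-larger : length (descents cars cars) ≡ length (descents cars (suc N))
      no-larger with suc (suc N) ≤? suc N
      ... | yes le = contradiction le 1+n≰n
      ... | no  _  = cong length (++-identityʳ (descents cars (suc N)))

  module BoundedCase (a∤b : a ∤ b) (b<Na : b < suc N * a) where

    q = b / a

    q≤N : q ≤ N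
    q≤N = ≤-pred (m<n*o⇒m/o<n b<Na)

    q<n : q < cars
    q<n = s≤s (m≤n⇒m≤1+n q≤N)

    PAinv⇔Stair : ∀ x → x ∈ PAinv (lengths cars a b) ⇔ Stair a q (prefs x)
    PAinv⇔Stair x = mk⇔ (λ inv → BoundedNecessity.stair-bounded m≡ inv a∤b)
                        (sufficient (m≤n⇒m≤1+n q≤N) (inj₂ (m/n*n≤m b a)))

    characterisation : ∀ x → x ∈ PAinv (lengths cars a b) ⇔
      (∀ i → (spot i ≤ q + 1 → orderStatistic x i ∈ Progression a (spot i))
           × (¬ (spot i ≤ q + 1) → orderStatistic x i ∈ Progression a (q + 1)))
    characterisation x = mk⇔
      (λ inv i → let c , c≤i , c≤q , eq = to (Stair⇔rearranged x) (to (PAinv⇔Stair x) inv) i in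
        (λ _ → Progression⁺ (s≤s c≤i) eq) , (λ _ → Progression⁺ (subst (c <_) (+-comm 1 q) (s≤s c≤q)) eq))
      (λ prog → from (PAinv⇔Stair x) (from (Stair⇔rearranged x) λ i → at i (prog i) (spot i ≤? q + 1)))
      where
      open Equivalence
      at : ∀ i → (spot i ≤ q + 1 → orderStatistic x i ∈ Progression a (spot i))
               × (¬ (spot i ≤ q + 1) → orderStatistic x i ∈ Progression a (q + 1)) →
           Dec (spot i ≤ q + 1) → ∃[ c ] c ≤ toℕ i × c ≤ q × toℕ (lookup (rearrange↑ x) i) ≡ c * a
      at i (low , _) (yes i≤q) =
        let c , c<1+i , eq = Progression⁻ (low i≤q) in
        c , ≤-pred c<1+i , ≤-pred (<-≤-trans c<1+i (subst (spot i ≤_) (+-comm q 1) i≤q)) , eq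
      at i (_ , high) (no i≰q) =
        let c , c<q+1 , eq = Progression⁻ (high i≰q) in
        c , ≤-pred (<-trans c<q+1 (≰⇒> i≰q)) , ≤-pred (subst (c <_) (+-comm q 1) c<q+1) , eq

    count : ∃[ c ] HasCardinality (PAinv (lengths cars a b)) c
      × + c ≡ ∑[ j ≤ cars ∸ q ∸ 1 ]
                ((-1ℤ ℤ.^ toℕ j) ℤ.* (+ (cars C toℕ j))
                  ℤ.* (+ ((cars ∸ q ∸ toℕ j) ^ toℕ j))
                  ℤ.* (+ ((cars ∸ toℕ j + 1) ^ (cars ∸ toℕ j ∸ 1))))
    count = length (boundedPFs (suc q) cars) ,
            Units.cardinality (street-bound (m≤n⇒m≤1+n q≤N)) PAinv⇔Stair q<n ,
            boundedCount boundedPFs-recursion q<n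

    count↑ : ∃[ c ] HasCardinality (PAinv↑ (lengths cars a b)) c
      × (+ c) ℚ./ 1 ≡ ((+ (cars ∸ q + 1)) ℚ./ suc cars) ℚ.* ((+ ((cars + q) C q)) ℚ./ 1)
    count↑ = length (descents cars q) , Units.cardinality↑ (street-bound (m≤n⇒m≤1+n q≤N)) PAinv⇔Stair ,
             ℕ-ratio (length (descents cars q)) (cars ∸ q + 1) ((cars + q) C q) cars (ballot (<⇒≤ q<n))

theorem3 : ∀ (n a b : ℕ) .{{_ : NonZero a}} .{{_ : NonZero b}} → 2 ≤ n →
    let y = lengths n a b in
    ( (a ∣ b) ⊎ (b > (n ∸ 1) * a) →
    ( (∀ (x : Vec (Fin (sum y)) n) →
    x ∈ PAinv y ⇔ (∀ (i : Fin n) → orderStatistic x i ∈ Progression a (spot i)))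
    × HasCardinality (PAinv y) ((n + 1) ^ (n ∸ 1))
    × (∃[ c ] HasCardinality (PAinv↑ y) c
    × (+ c) ℚ./ 1 ≡ ((+ 1) ℚ./ suc n) ℚ.* ((+ ((2 * n) C n)) ℚ./ 1)) ) )
    ×
    ( (a ∤ b) → b < (n ∸ 1) * a →
    ( (∀ (x : Vec (Fin (sum y)) n) →
    x ∈ PAinv y ⇔
    (∀ (i : Fin n) →
    (spot i ≤ b / a + 1 → orderStatistic x i ∈ Progression a (spot i))
    × (¬ (spot i ≤ b / a + 1) → orderStatistic x i ∈ Progression a (b / a + 1))))
    × (∃[ c ] HasCardinality (PAinv y) c
    × + c ≡ ∑[ j ≤ n ∸ b / a ∸ 1 ]
    ((-1ℤ ℤ.^ toℕ j) ℤ.* (+ (n C toℕ j))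
    ℤ.* (+ ((n ∸ b / a ∸ toℕ j) ^ toℕ j))
    ℤ.* (+ ((n ∸ toℕ j + 1) ^ (n ∸ toℕ j ∸ 1)))))
    × (∃[ c ] HasCardinality (PAinv↑ y) c
    × (+ c) ℚ./ 1 ≡ ((+ (n ∸ b / a + 1)) ℚ./ suc n) ℚ.* ((+ ((n + b / a) C (b / a))) ℚ./ 1)) ) )
theorem3 (suc (suc N)) a b (s≤s (s≤s z≤n)) =
  (λ choice → let open Unbounded choice in characterisation , count , count↑) ,
  (λ a∤b b<Na → let open BoundedCase a∤b b<Na in characterisation , count , count↑)
  where open Street N a b
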